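{- Let $A$ be a finite abelian group. (i) $(\Delta A)^2$ has a lattice basis (i.e. a $\mathbb{Z}$-basis) consisting of elements of the form $(a-1)(b-1)$ with $a,b\in A$. (ii) If either $|A|>4$ or $A\cong C_2\times C_2$, then $(\Delta A)^2$ has a lattice basis consisting of elements of length $2$.
   Context: $A$ is written multiplicatively; $\mathbb{Z}A$ is its integral group ring, and $\Delta A=\{\sum_{a\in A} r_a a\in\mathbb{Z}A : \sum_a r_a=0\}$ is the augmentation ideal. $(\Delta A)^2$ is the additive subgroup of $\mathbb{Z}A$ generated by all products $xy$ with $x,y\in\Delta A$. The length of $x=\sum_a x_a a$ is $\|x\|=\sqrt{\sum_a x_a^2}$. $C_2$ is the cyclic group of order $2$. -}

module Defs where

open import Algebra.Bundles using (AbelianGroup; RawRing)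
import Algebra.Construct.DirectProduct as DirectProduct
import Algebra.Definitions.RawMonoid as RawMonoidDefs
open import Algebra.Morphism.Structures using (module GroupMorphisms)
open import Algebra.Properties.CommutativeMonoid.Sum using (sum-cong-≗)
open import Data.Bool.Base using (if_then_else_)
open import Data.Fin.Base using (Fin)
open import Data.Fin.Properties using (_≟_)
open import Data.Integer.Base as ℤ using (ℤ; +_; 0ℤ; 1ℤ)
import Data.Integer.Properties as ℤ
open import Data.Nat.Base as ℕ using (ℕ)
import Data.Parity.Properties as ℙ
open import Data.Product.Base using (∃; ∃₂; Σ-syntax; _×_)
open import Data.Vec.Functional using (Vector)
open import Function.Bundles using (Func; Inverse)
open import Level using (Level; 0ℓ; _⊔_; suc)
open import Relation.Binary.PropositionalEquality as ≡ using (_≡_)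
open import Relation.Nullary.Decidable using (does)
open import Relation.Unary using (Pred; _∈_)

infix 4 _≅_
_≅_ : ∀ {a b ℓ₁ ℓ₂} → AbelianGroup a ℓ₁ → AbelianGroup b ℓ₂ →
      Set (a ⊔ b ⊔ ℓ₁ ⊔ ℓ₂)
G ≅ H = ∃ λ (φ : G.Carrier → H.Carrier) → IsGroupIsomorphism φ
  where
  module G = AbelianGroup G
  module H = AbelianGroup H
  open GroupMorphisms G.rawGroup H.rawGroup using (IsGroupIsomorphism)

C₂ : AbelianGroup 0ℓ 0ℓ
C₂ = ℙ.+-0-abelianGroup

C₂×C₂ : AbelianGroup 0ℓ 0ℓ
C₂×C₂ = DirectProduct.abelianGroup C₂ C₂

record FiniteAbelianGroup c ℓ : Set (suc (c ⊔ ℓ)) where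
  field
    abelianGroup : AbelianGroup c ℓ
    order        : ℕ
    enumeration  : Inverse (≡.setoid (Fin order))
                           (AbelianGroup.setoid abelianGroup)

  open AbelianGroup abelianGroup public
    using (Carrier; setoid; _∙_; ε; _⁻¹; ∙-congˡ)

  element : Fin order → Carrier
  element = Inverse.to enumeration

  index : Carrier → Fin order
  index = Inverse.from enumeration

module GroupRing {c ℓ} (A : FiniteAbelianGroup c ℓ) where
  open FiniteAbelianGroup A

  ∑ : (Carrier → ℤ) → ℤ
  ∑ f = RawMonoidDefs.sum ℤ.+-0-rawMonoid (λ i → f (element i))

  -- As A is finite, Σₐ xₐ a is given by an arbitrary function a ↦ xₐ that
  -- respects the equality of A.
  ℤA : Set (c ⊔ ℓ)
  ℤA = Func setoid (≡.setoid ℤ)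

  infixl 9 _⟦_⟧
  _⟦_⟧ : ℤA → Carrier → ℤ
  x ⟦ a ⟧ = Func.to x a

  private
    -- The coefficient of g in x * y collects all xₐ y_b with a ∙ b ≈ g,
    -- that is, b ≈ a ⁻¹ ∙ g.
    convolution : ℤA → ℤA → ℤA
    convolution x y = record
      { to   = λ g → ∑ λ a → x ⟦ a ⟧ ℤ.* y ⟦ a ⁻¹ ∙ g ⟧
      ; cong = λ g≈h → sum-cong-≗ ℤ.+-0-commutativeMonoid λ i →
          ≡.cong (x ⟦ element i ⟧ ℤ.*_) (Func.cong y (∙-congˡ g≈h))
      }

  ι : Carrier → ℤA
  ι a = record
    { to   = λ g → if does (index a ≟ index g) then 1ℤ else 0ℤ
    ; cong = λ g≈h → ≡.cong (λ i → if does (index a ≟ i) then 1ℤ else 0ℤ)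
                            (Inverse.from-cong enumeration g≈h)
    }

  ℤA-rawRing : RawRing (c ⊔ ℓ) c
  ℤA-rawRing = record
    { Carrier = ℤA
    ; _≈_     = λ x y → ∀ a → x ⟦ a ⟧ ≡ y ⟦ a ⟧
    ; _+_     = λ x y → record
        { to   = λ a → x ⟦ a ⟧ ℤ.+ y ⟦ a ⟧
        ; cong = λ a≈b → ≡.cong₂ ℤ._+_ (Func.cong x a≈b) (Func.cong y a≈b)
        }
    ; _*_     = convolution
    ; -_      = λ x → record
        { to   = λ a → ℤ.- (x ⟦ a ⟧)
        ; cong = λ a≈b → ≡.cong ℤ.-_ (Func.cong x a≈b)
        }
    ; 0#      = record { to = λ _ → 0ℤ ; cong = λ _ → ≡.refl }
    ; 1#      = ι ε
    }

  open RawRing ℤA-rawRing public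
    using (_≈_; _+_; _*_; -_; 0#; 1#; +-rawMonoid)

  open RawMonoidDefs +-rawMonoid public using (sum)

  infixl 6 _-_
  _-_ : ℤA → ℤA → ℤA
  x - y = x + (- y)

  infixr 8 _•_
  _•_ : ℤ → ℤA → ℤA
  n • x = record
    { to   = λ a → n ℤ.* x ⟦ a ⟧
    ; cong = λ a≈b → ≡.cong (n ℤ.*_) (Func.cong x a≈b)
    }

  data AdditiveSubgroup {p} (P : Pred ℤA p) : Pred ℤA (c ⊔ ℓ ⊔ p) where
    generator : ∀ {x} → x ∈ P → x ∈ AdditiveSubgroup P
    zero      : 0# ∈ AdditiveSubgroup P
    plus      : ∀ {x y} → x ∈ AdditiveSubgroup P → y ∈ AdditiveSubgroup P →
                x + y ∈ AdditiveSubgroup P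
    negate    : ∀ {x} → x ∈ AdditiveSubgroup P → - x ∈ AdditiveSubgroup P
    respects  : ∀ {x y} → x ≈ y → x ∈ AdditiveSubgroup P →
                y ∈ AdditiveSubgroup P

  Δ : Pred ℤA 0ℓ
  Δ x = ∑ (x ⟦_⟧) ≡ 0ℤ

  Δ² : Pred ℤA (c ⊔ ℓ)
  Δ² = AdditiveSubgroup λ z → ∃₂ λ x y → x ∈ Δ × y ∈ Δ × z ≈ x * y

  record IsLatticeBasis {p} (L : Pred ℤA p) {m} (v : Vector ℤA m) :
                        Set (c ⊔ ℓ ⊔ p) where
    field
      member      : ∀ i → v i ∈ L
      independent : ∀ (n : Vector ℤ m) → sum (λ i → n i • v i) ≈ 0# →
                    ∀ i → n i ≡ 0ℤ
      spanning    : ∀ {x} → x ∈ L →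
                    ∃ λ (n : Vector ℤ m) → x ≈ sum (λ i → n i • v i)

  HasLatticeBasisOf : ∀ {p q} → Pred ℤA p → Pred ℤA q → Set (c ⊔ ℓ ⊔ p ⊔ q)
  HasLatticeBasisOf L Q =
    Σ[ m ∈ ℕ ] Σ[ v ∈ Vector ℤA m ] IsLatticeBasis L v × (∀ i → v i ∈ Q)

  ProductForm : Pred ℤA c
  ProductForm x = ∃₂ λ a b → x ≈ (ι a - 1#) * (ι b - 1#)

  -- The length is the nonnegative square root of Σₐ xₐ²; for r : ℕ, having
  -- length r thus means that Σₐ xₐ² = r².
  HasLength : ℕ → Pred ℤA 0ℓ
  HasLength r x = ∑ (λ a → x ⟦ a ⟧ ℤ.* x ⟦ a ⟧) ≡ + (r ℕ.* r)

{-# OPTIONS --safe #-}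

-- Writing [a] = a − 1, we have (a − 1)(b − 1) = [ab] − [a] − [b], so a family
-- of such products is a basis of (ΔA)² iff the relations [ab] = [a] + [b] it
-- names present A minimally: they imply all others and are independent.
--
-- Such families are built along a chain of cyclic extensions H < K = H⟨g⟩ of
-- degree m. To a family for H one adds [gⁱx] = [gⁱ] + [x] for 1 ≠ x ∈ H and
-- [gⁱ⁺¹uᵢ] = [gⁱuᵢ] + [g] for 0 < i < m, where the uᵢ ∈ H are arbitrary; a
-- relation [ab] = [a] + [b] of H may be replaced by [g ab] = [g a] + [b].
--
-- The product (a − 1)(b − 1) has length 2 iff 1, a, b, ab are distinct. After
-- the replacement in the last extension, the old relations always satisfy
-- this, and so do the new ones if u₁ ≠ 1 and gᵐuₘ₋₁ ≠ 1. Suitable uᵢ exist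
-- unless H = 1 or A is cyclic of order 4; if H = 1, then A is cyclic and a
-- separate family serves for order at least 5.
module Submission where

open import Defs
open import Algebra.Bundles using (AbelianGroup)
open import Algebra.Morphism.Structures using (module GroupMorphisms)
import Algebra.Properties.AbelianGroup
import Algebra.Properties.Monoid.Mult
import Algebra.Properties.Semiring.Sum
open import Data.Bool.Base using (if_then_else_)
open import Data.Fin.Base using (Fin; zero; suc; toℕ; fromℕ; fromℕ<; inject₁)
open import Data.Fin.Patterns using (0F; 1F; 2F; 3F)
import Data.Fin.Properties as Fin
open import Data.Fin.Relation.Unary.Top using (View; view; ‵fromℕ; ‵inj₁)
open import Data.Integer.Base as ℤ using (ℤ; +_; 0ℤ; 1ℤ)
import Data.Integer.Properties as ℤ
open import Data.Integer.Tactic.RingSolver using (solve-∀)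
open import Data.Maybe.Base as Maybe using (Maybe; just; nothing; maybe′)
open import Data.Maybe.Properties using (just-injective)
open import Data.Nat.Base as ℕ using (ℕ; zero; suc; _>_)
import Data.Nat.Properties as ℕ
import Data.Nat.Tactic.RingSolver as ℕ-Solver
open import Data.Parity.Base using (Parity; 0ℙ; 1ℙ)
import Data.Parity.Properties as ℙ
open import Data.Product.Base using (∃; _×_; _,_; proj₁; proj₂)
open import Data.Product.Function.NonDependent.Propositional using (_×-↔_)
open import Data.Product.Properties using (≡-dec)
open import Data.Sum.Base as Sum using (_⊎_; inj₁; inj₂; [_,_]′)
open import Data.Sum.Function.Propositional using (_⊎-↔_)
open import Data.Vec.Functional using (Vector; removeAt)
open import Function.Base using (_∘_; id; case_of_)
open import Function.Bundles using (_↔_; mk↔ₛ′; Inverse; Func; _⇔_; mk⇔; Equivalence)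
open import Function.Properties.Inverse using (↔-refl; ↔-trans; ↔-sym; ↔⇒↣)
open import Level using (Level; _⊔_)
open import Relation.Binary.Definitions using (DecidableEquality)
open import Relation.Binary.PropositionalEquality as ≡
  using (_≡_; _≢_; refl; cong; subst-injective)
open import Relation.Nullary using (¬_; Dec; yes; no; does; contradiction; ¬?)
open import Relation.Nullary.Decidable
  using (map′; decidable-stable; via-injection; dec-true; dec-false; does-⇔)
open import Relation.Unary using (_∈_)
open Algebra.Properties.Semiring.Sum ℤ.+-*-semiring
  using (sum-cong-≗; sum-remove; sum-replicate-zero; ∑-distrib-+; ∑-comm; *-distribˡ-sum; *-distribʳ-sum)
  renaming (sum to sumℤ)

-- Spanning and independence are proved by dual arguments. That the relations imply all others is
-- stated for maps into every abelian group, so that it can be applied to the integer functions on A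
-- modulo the span of the family, with F(a) = a - 1. There F(ab) = F(a) + F(b) says exactly that (a
-- - 1)(b - 1) lies in the span, and these products span (ΔA)². For independence, a function d : A →
-- ℤ with d(1) = 0 pairs with (a - 1)(b - 1) to d(ab) - d(a) - d(b). A finite group has no nonzero
-- homomorphism to ℤ, so every nonzero d violates some relation; the functions used are built to
-- violate one given relation and otherwise only relations whose coefficients are already known to
-- vanish. A typical one is additive up to multiples of the degree of the extension, with a single
-- jump by that degree.

Fin-suc↔Maybe : ∀ {n} {X : Set} → Fin n ↔ X → Fin (suc n) ↔ Maybe X
Fin-suc↔Maybe {n} {X} e = mk↔ₛ′ f f⁻¹ ff⁻¹ f⁻¹f
  where
  f : Fin (suc n) → Maybe X
  f zero    = nothing
  f (suc i) = just (Inverse.to e i)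
  f⁻¹ : Maybe X → Fin (suc n)
  f⁻¹ nothing  = zero
  f⁻¹ (just x) = suc (Inverse.from e x)
  ff⁻¹ : ∀ y → f (f⁻¹ y) ≡ y
  ff⁻¹ nothing  = refl
  ff⁻¹ (just x) = cong just (Inverse.strictlyInverseˡ e x)
  f⁻¹f : ∀ i → f⁻¹ (f i) ≡ i
  f⁻¹f zero    = refl
  f⁻¹f (suc i) = cong suc (Inverse.strictlyInverseʳ e i)

-- Serves for the nontrivial elements of an extension and for its relations alike; both grow by the
-- same amount, so the chain of extensions keeps them equal in number.
Fin+*↔ : ∀ {m n k} {X Y : Set} → Fin n ↔ X → Fin k ↔ Y →
         Fin (n ℕ.+ m ℕ.* suc k) ↔ (X ⊎ (Fin m × Maybe Y))
Fin+*↔ e f = ↔-trans Fin.+↔⊎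
  (e ⊎-↔ ↔-trans Fin.*↔× (↔-refl ×-↔ Fin-suc↔Maybe f))

-- Subgroups and their cyclic extensions in normal form gⁱh

module Subgroups {c ℓ} (A : AbelianGroup c ℓ) where

  open AbelianGroup A using (Carrier; _≈_; _∙_; ε; setoid; commutativeMonoid;
    ∙-cong; ∙-congˡ; ∙-congʳ; identityˡ; identityʳ; assoc)
  private module A = AbelianGroup A
  open import Algebra.Properties.AbelianGroup A using (∙-cancelˡ)
  open import Algebra.Properties.Monoid.Mult A.monoid
    using (×-homo-+; ×-congˡ) renaming (_×_ to _⋆_)
  open import Algebra.Solver.CommutativeMonoid commutativeMonoid using (solve; _⊜_; _⊕_)
  open import Relation.Binary.Reasoning.Setoid setoid

  -- The elements of a subgroup are encoded by Maybe X, with nothing for the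
  -- unit, so that X indexes the nontrivial elements.
  record Subgroup : Set (Level.suc Level.zero ⊔ c ⊔ ℓ) where
    field
      X        : Set
      size     : ℕ
      elements : Fin size ↔ X
      nonunit  : X → Carrier

    el : Maybe X → Carrier
    el = maybe′ nonunit ε

    field
      el-injective : ∀ {y z} → el y ≈ el z → y ≡ z
      mul          : Maybe X → Maybe X → Maybe X
      el-mul       : ∀ y z → el (mul y z) ≈ el y ∙ el z
      inv          : Maybe X → Maybe X
      el-inv       : ∀ y → el y ∙ el (inv y) ≈ ε

    Full : Set (c ⊔ ℓ)
    Full = ∀ a → ∃ λ y → el y ≈ a

  trivial : Subgroup
  trivial = record
    { X = Fin 0 ; size = 0 ; elements = ↔-refl
    ; nonunit = λ ()
    ; el-injective = λ { {nothing} {nothing} _ → refl }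
    ; mul = λ _ _ → nothing
    ; el-mul = λ { nothing nothing → A.sym (identityˡ ε) }
    ; inv = λ _ → nothing
    ; el-inv = λ { nothing → identityˡ ε }
    }

  -- Data for the extension H⟨g⟩ of H, of degree 2 + p.
  record Extension (H : Subgroup) : Set (c ⊔ ℓ) where
    open Subgroup H
    field
      g       : Carrier
      p       : ℕ
      z       : Maybe X
      el-z    : el z ≈ (2 ℕ.+ p) ⋆ g
      minimal : ∀ (i : Fin (suc p)) y → ¬ el y ≈ suc (toℕ i) ⋆ g

  module Extended (H : Subgroup) (E : Extension H) where
    open Subgroup H
    open Extension E

    X′ : Set
    X′ = X ⊎ (Fin (suc p) × Maybe X)

    pair : Fin (2 ℕ.+ p) → Maybe X → Maybe X′
    pair zero    h = Maybe.map inj₁ h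
    pair (suc i) h = just (inj₂ (i , h))

    -- A view of every element as gⁱh. It is needed because `pair` is not a constructor: at exponent
    -- 0 its value depends on whether h is the unit.
    data Coordinates : Maybe X′ → Set where
      at : ∀ i h → Coordinates (pair i h)

    coordinates : ∀ y → Coordinates y
    coordinates nothing               = at zero nothing
    coordinates (just (inj₁ x))       = at zero (just x)
    coordinates (just (inj₂ (i , h))) = at (suc i) h

    nonunit′ : X′ → Carrier
    nonunit′ (inj₁ x)       = nonunit x
    nonunit′ (inj₂ (i , h)) = suc (toℕ i) ⋆ g ∙ el h

    el′ : Maybe X′ → Carrier
    el′ = maybe′ nonunit′ ε

    el-pair : ∀ i h → el′ (pair i h) ≈ toℕ i ⋆ g ∙ el h
    el-pair zero    nothing  = A.sym (identityˡ ε)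
    el-pair zero    (just x) = A.sym (identityˡ _)
    el-pair (suc i) h        = A.refl

    -- For positive k the equation puts gᵏ = h h′⁻¹ into H, against the minimality of the degree.
    coset-disjoint : ∀ k h h′ → k ℕ.< 2 ℕ.+ p → el h ≈ k ⋆ g ∙ el h′ → k ≡ 0
    coset-disjoint zero    h h′ _           _  = refl
    coset-disjoint (suc k) h h′ (ℕ.s≤s k<m) eq = contradiction (begin
      el (mul h (inv h′))                       ≈⟨ el-mul h (inv h′) ⟩
      el h ∙ el (inv h′)                        ≈⟨ ∙-congʳ eq ⟩
      suc k ⋆ g ∙ el h′ ∙ el (inv h′)           ≈⟨ assoc _ _ _ ⟩
      suc k ⋆ g ∙ (el h′ ∙ el (inv h′))         ≈⟨ ∙-congˡ (el-inv h′) ⟩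
      suc k ⋆ g ∙ ε                             ≈⟨ identityʳ _ ⟩
      suc k ⋆ g                                 ≡⟨ cong (λ i → suc i ⋆ g) (Fin.toℕ-fromℕ< k<m) ⟨
      suc (toℕ (fromℕ< k<m)) ⋆ g                ∎)
      (minimal (fromℕ< k<m) (mul h (inv h′)))

    -- Cancelling gⁱ leaves h = gᵏh′ with k = j - i, and `coset-disjoint` gives k = 0.
    pair-injective-≤ : ∀ i j h h′ → toℕ i ℕ.≤ toℕ j →
                       el′ (pair i h) ≈ el′ (pair j h′) → pair i h ≡ pair j h′
    pair-injective-≤ i j h h′ i≤j eq =
      ≡.cong₂ pair (Fin.toℕ-injective i≡j) (el-injective h≈h′)
      where
      k : ℕ
      k = toℕ j ℕ.∸ toℕ i
      j≡ : toℕ j ≡ toℕ i ℕ.+ k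
      j≡ = ≡.sym (ℕ.m+[n∸m]≡n i≤j)
      h≈ : el h ≈ k ⋆ g ∙ el h′
      h≈ = ∙-cancelˡ (toℕ i ⋆ g) _ _ (begin
        toℕ i ⋆ g ∙ el h              ≈⟨ el-pair i h ⟨
        el′ (pair i h)                ≈⟨ eq ⟩
        el′ (pair j h′)               ≈⟨ el-pair j h′ ⟩
        toℕ j ⋆ g ∙ el h′             ≡⟨ cong (λ n → n ⋆ g ∙ el h′) j≡ ⟩
        (toℕ i ℕ.+ k) ⋆ g ∙ el h′     ≈⟨ ∙-congʳ (×-homo-+ g (toℕ i) k) ⟩
        toℕ i ⋆ g ∙ k ⋆ g ∙ el h′     ≈⟨ assoc _ _ _ ⟩
        toℕ i ⋆ g ∙ (k ⋆ g ∙ el h′)   ∎)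
      k≡0 : k ≡ 0
      k≡0 = coset-disjoint k h h′ (ℕ.≤-<-trans (ℕ.m∸n≤m (toℕ j) (toℕ i)) (Fin.toℕ<n j)) h≈
      i≡j : toℕ i ≡ toℕ j
      i≡j = ≡.sym (≡.trans j≡ (≡.trans (cong (toℕ i ℕ.+_) k≡0) (ℕ.+-identityʳ _)))
      h≈h′ : el h ≈ el h′
      h≈h′ = A.trans h≈ (A.trans (∙-congʳ (×-congˡ k≡0)) (identityˡ _))

    el′-injective : ∀ {y y′} → el′ y ≈ el′ y′ → y ≡ y′
    el′-injective {y} {y′} eq with coordinates y | coordinates y′
    ... | at i h | at j h′ with ℕ.≤-total (toℕ i) (toℕ j)
    ...   | inj₁ i≤j = pair-injective-≤ i j h h′ i≤j eq
    ...   | inj₂ j≤i = ≡.sym (pair-injective-≤ j i h′ h j≤i (A.sym eq))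

    -- Multiplication by g in normal form: from the top exponent it wraps to exponent 0 with the
    -- carry z = gᵐ.
    next : ∀ {i : Fin (2 ℕ.+ p)} → View i → Maybe X → Maybe X′
    next ‵fromℕ           h = pair zero (mul z h)
    next (‵inj₁ {i = i} _) h = pair (suc i) h

    el-next : ∀ {i : Fin (2 ℕ.+ p)} (v : View i) h → el′ (next v h) ≈ g ∙ el′ (pair i h)
    el-next ‵fromℕ h = begin
      el′ (pair zero (mul z h))                  ≈⟨ el-pair zero (mul z h) ⟩
      ε ∙ el (mul z h)                           ≈⟨ identityˡ _ ⟩
      el (mul z h)                               ≈⟨ el-mul z h ⟩
      el z ∙ el h                                ≈⟨ ∙-congʳ el-z ⟩
      (2 ℕ.+ p) ⋆ g ∙ el h                       ≡⟨ cong (λ n → suc n ⋆ g ∙ el h) (Fin.toℕ-fromℕ (suc p)) ⟨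
      g ∙ toℕ (fromℕ (suc p)) ⋆ g ∙ el h         ≈⟨ assoc _ _ _ ⟩
      g ∙ (toℕ (fromℕ (suc p)) ⋆ g ∙ el h)       ≈⟨ ∙-congˡ (el-pair (fromℕ (suc p)) h) ⟨
      g ∙ el′ (pair (fromℕ (suc p)) h)           ∎
    el-next (‵inj₁ {i = i} _) h = begin
      g ∙ toℕ i ⋆ g ∙ el h                 ≡⟨ cong (λ n → g ∙ n ⋆ g ∙ el h) (Fin.toℕ-inject₁ i) ⟨
      g ∙ toℕ (inject₁ i) ⋆ g ∙ el h       ≈⟨ assoc _ _ _ ⟩
      g ∙ (toℕ (inject₁ i) ⋆ g ∙ el h)     ≈⟨ ∙-congˡ (el-pair (inject₁ i) h) ⟨
      g ∙ el′ (pair (inject₁ i) h)         ∎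

    step : Maybe X′ → Maybe X′
    step y with coordinates y
    ... | at i h = next (view i) h

    el-step : ∀ y → el′ (step y) ≈ g ∙ el′ y
    el-step y with coordinates y
    ... | at i h = el-next (view i) h

    steps : ℕ → Maybe X′ → Maybe X′
    steps zero    y = y
    steps (suc k) y = step (steps k y)

    el-steps : ∀ k y → el′ (steps k y) ≈ k ⋆ g ∙ el′ y
    el-steps zero    y = A.sym (identityˡ _)
    el-steps (suc k) y = begin
      el′ (step (steps k y))   ≈⟨ el-step (steps k y) ⟩
      g ∙ el′ (steps k y)      ≈⟨ ∙-congˡ (el-steps k y) ⟩
      g ∙ (k ⋆ g ∙ el′ y)      ≈⟨ assoc _ _ _ ⟨
      suc k ⋆ g ∙ el′ y        ∎

    act : Maybe X → Maybe X′ → Maybe X′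
    act h y with coordinates y
    ... | at i h′ = pair i (mul h h′)

    el-act : ∀ h y → el′ (act h y) ≈ el h ∙ el′ y
    el-act h y with coordinates y
    ... | at i h′ = begin
      el′ (pair i (mul h h′))      ≈⟨ el-pair i (mul h h′) ⟩
      toℕ i ⋆ g ∙ el (mul h h′)    ≈⟨ ∙-congˡ (el-mul h h′) ⟩
      toℕ i ⋆ g ∙ (el h ∙ el h′)   ≈⟨ solve 3 (λ a b c → a ⊕ (b ⊕ c) ⊜ b ⊕ (a ⊕ c)) A.refl _ _ _ ⟩
      el h ∙ (toℕ i ⋆ g ∙ el h′)   ≈⟨ ∙-congˡ (el-pair i h′) ⟨
      el h ∙ el′ (pair i h′)       ∎

    -- Multiplies by gⁱ in single steps instead of adding exponents modulo m. A map that respects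
    -- one step of g and the action of H then respects the product, by induction on i.
    mul′ : Maybe X′ → Maybe X′ → Maybe X′
    mul′ y y′ with coordinates y
    ... | at i h = act h (steps (toℕ i) y′)

    el-mul′ : ∀ y y′ → el′ (mul′ y y′) ≈ el′ y ∙ el′ y′
    el-mul′ y y′ with coordinates y
    ... | at i h = begin
      el′ (act h (steps (toℕ i) y′))   ≈⟨ el-act h (steps (toℕ i) y′) ⟩
      el h ∙ el′ (steps (toℕ i) y′)    ≈⟨ ∙-congˡ (el-steps (toℕ i) y′) ⟩
      el h ∙ (toℕ i ⋆ g ∙ el′ y′)      ≈⟨ solve 3 (λ a b c → a ⊕ (b ⊕ c) ⊜ (b ⊕ a) ⊕ c) A.refl _ _ _ ⟩
      toℕ i ⋆ g ∙ el h ∙ el′ y′        ≈⟨ ∙-congʳ (el-pair i h) ⟨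
      el′ (pair i h) ∙ el′ y′          ∎

    inv′ : Maybe X′ → Maybe X′
    inv′ y with coordinates y
    -- The inverse of gⁱh is gᵐ⁻ⁱ(zh)⁻¹, since gᵐ = z. At i = 0 the m steps from the unit wrap round
    -- to z, so this exponent needs no case of its own.
    ... | at i h = act (inv (mul z h)) (steps (2 ℕ.+ p ℕ.∸ toℕ i) nothing)

    el-inv′ : ∀ y → el′ y ∙ el′ (inv′ y) ≈ ε
    el-inv′ y with coordinates y
    ... | at i h = begin
      el′ (pair i h) ∙ el′ (act w (steps k nothing))   ≈⟨ ∙-cong (el-pair i h) (el-act w (steps k nothing)) ⟩
      toℕ i ⋆ g ∙ el h ∙ (el w ∙ el′ (steps k nothing))
        ≈⟨ ∙-congˡ (∙-congˡ (A.trans (el-steps k nothing) (identityʳ _))) ⟩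
      toℕ i ⋆ g ∙ el h ∙ (el w ∙ k ⋆ g)
        ≈⟨ solve 4 (λ a b c d → (a ⊕ b) ⊕ (c ⊕ d) ⊜ ((a ⊕ d) ⊕ b) ⊕ c) A.refl _ _ _ _ ⟩
      toℕ i ⋆ g ∙ k ⋆ g ∙ el h ∙ el w                  ≈⟨ ∙-congʳ (∙-congʳ (×-homo-+ g (toℕ i) k)) ⟨
      (toℕ i ℕ.+ k) ⋆ g ∙ el h ∙ el w
        ≈⟨ ∙-congʳ (∙-congʳ (×-congˡ (ℕ.m+[n∸m]≡n (ℕ.<⇒≤ (Fin.toℕ<n i))))) ⟩
      (2 ℕ.+ p) ⋆ g ∙ el h ∙ el w                      ≈⟨ ∙-congʳ (∙-congʳ el-z) ⟨
      el z ∙ el h ∙ el w                               ≈⟨ ∙-congʳ (el-mul z h) ⟨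
      el (mul z h) ∙ el w                              ≈⟨ el-inv (mul z h) ⟩
      ε                                                ∎
      where
      w = inv (mul z h)
      k = 2 ℕ.+ p ℕ.∸ toℕ i

    extended : Subgroup
    extended = record
      { X = X′ ; size = size ℕ.+ suc p ℕ.* suc size ; elements = Fin+*↔ elements elements
      ; nonunit = nonunit′
      ; el-injective = el′-injective
      ; mul = mul′ ; el-mul = el-mul′
      ; inv = inv′ ; el-inv = el-inv′
      }

-- Step functions on exponents

-- The unit step with its only jump between `a` and `suc a`: among relations that raise an exponent
-- by one, it tells apart the single one that crosses the jump.
above : ℕ → ℕ → ℤ
above _       zero    = 0ℤ
above zero    (suc _) = 1ℤ
above (suc a) (suc k) = above a k

above-self : ∀ a → above a a ≡ 0ℤ
above-self zero    = refl
above-self (suc a) = above-self a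

above-< : ∀ {a k} → a ℕ.< k → above a k ≡ 1ℤ
above-< {zero}  {suc k} _           = refl
above-< {suc a} {suc k} (ℕ.s≤s a<k) = above-< a<k

above-suc : ∀ {a k} → k ≢ a → above a (suc k) ≡ above a k
above-suc {zero}  {zero}  k≢a = contradiction refl k≢a
above-suc {zero}  {suc k} _   = refl
above-suc {suc a} {zero}  _   = refl
above-suc {suc a} {suc k} k≢a = above-suc (k≢a ∘ cong suc)

+suc*≢0 : ∀ n {i} → i ≢ 0ℤ → + suc n ℤ.* i ≢ 0ℤ
+suc*≢0 n i≢0 eq with ℤ.i*j≡0⇒i≡0∨j≡0 (+ suc n) eq
... | inj₁ ()
... | inj₂ i≡0 = i≢0 i≡0

-- Presentations by relations [ab] = [a] + [b], and their extension

module Presentations {c ℓ} (A : AbelianGroup c ℓ) (a b : Level) where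

  open AbelianGroup A using (_≈_; _∙_)
  private module A = AbelianGroup A
  open Subgroups A

  -- Each j stands for the relation [yy′] = [y] + [y′] with y = left j and
  -- y′ = right j. The field generates says that these relations imply all
  -- others, and eliminates that they are linearly independent: Z is the set
  -- of relations whose coefficients are known to vanish in a given dependency,
  -- and a functional d detecting only j and members of Z forces j into Z.
  record Presentation (H : Subgroup) : Set (Level.suc (a ⊔ b) ⊔ Level.suc Level.zero ⊔ ℓ) where
    open Subgroup H
    field
      J          : Set
      count      : ℕ
      relations  : Fin count ↔ J
      left       : J → Maybe X
      right      : J → X
      product    : J → Maybe X
      el-product : ∀ j → el (product j) ≈ el (left j) ∙ nonunit (right j)
      generates  : ∀ (G : AbelianGroup a b) (let module G = AbelianGroup G)
                   (F : Maybe X → G.Carrier) → F nothing G.≈ G.ε →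
                   (∀ j → F (product j) G.≈ F (left j) G.∙ F (just (right j))) →
                   ∀ y y′ → F (mul y y′) G.≈ F y G.∙ F y′

    -- For d vanishing at the unit this is the pairing of d with (a - 1)(b - 1); see `∑-defect`.
    defect : (Maybe X → ℤ) → J → ℤ
    defect d j = d (product j) ℤ.- d (left j) ℤ.- d (just (right j))

    field
      eliminates : ∀ (Z : J → Set) →
                   (∀ d j → d nothing ≡ 0ℤ → defect d j ≢ 0ℤ →
                    (∀ k → k ≢ j → Z k ⊎ defect d k ≡ 0ℤ) → Z j) →
                   ∀ j → Z j

    -- These three conditions make 1, a, b, ab distinct: b ≠ 1 is built into the type of `right`,
    -- and ab = a or ab = b would force b = 1 or a = 1.
    Quadrilateral : Set
    Quadrilateral = ∀ j → left j ≢ nothing × left j ≢ just (right j) × product j ≢ nothing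

  trivial-presentation : Presentation trivial
  trivial-presentation = record
    { J = Fin 0 ; count = 0 ; relations = ↔-refl
    ; left = λ () ; right = λ () ; product = λ () ; el-product = λ ()
    ; generates = λ { G F F0 _ nothing nothing →
        let module G = AbelianGroup G in
        G.sym (G.trans (G.∙-congʳ F0) (G.identityˡ _)) }
    ; eliminates = λ _ _ ()
    }

  module HomFromSteps (H : Subgroup) (E : Extension H)
    (G : AbelianGroup a b) (F : Maybe (Extended.X′ H E) → AbelianGroup.Carrier G) where
    open Subgroup H
    open Extension E
    open Extended H E
    private module G = AbelianGroup G
    open import Algebra.Properties.Monoid.Mult G.monoid using () renaming (_×_ to _⋆_)
    open import Algebra.Solver.CommutativeMonoid G.commutativeMonoid using (solve; _⊜_; _⊕_)
    open import Relation.Binary.Reasoning.Setoid G.setoid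

    F₀ : Maybe X → G.Carrier
    F₀ h = F (pair zero h)

    Fg : G.Carrier
    Fg = F (pair (suc zero) nothing)

    -- The hypotheses say how F behaves on H, on normal forms and under one step of g; these are the
    -- ingredients of `mul′`, which F is followed through.
    hom : (∀ h h′ → F₀ (mul h h′) G.≈ F₀ h G.∙ F₀ h′) →
          (∀ i h → F (pair i h) G.≈ F (pair i nothing) G.∙ F₀ h) →
          (∀ i h → F (next (view i) h) G.≈ Fg G.∙ F (pair i h)) →
          ∀ y y′ → F (mul′ y y′) G.≈ F y G.∙ F y′
    hom F₀-mul split F-next y y′ with coordinates y
    ... | at i h = begin
      F (act h (steps (toℕ i) y′))            ≈⟨ F-act h (steps (toℕ i) y′) ⟩
      F₀ h G.∙ F (steps (toℕ i) y′)           ≈⟨ G.∙-congˡ (F-steps (toℕ i) y′) ⟩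
      F₀ h G.∙ (toℕ i ⋆ Fg G.∙ F y′)          ≈⟨ solve 3 (λ a b c → a ⊕ (b ⊕ c) ⊜ (b ⊕ a) ⊕ c) G.refl _ _ _ ⟩
      toℕ i ⋆ Fg G.∙ F₀ h G.∙ F y′            ≈⟨ G.∙-congʳ (F-steps (toℕ i) (pair zero h)) ⟨
      -- Both arguments of F encode gⁱh, so they are equal by injectivity of the encoding, with no
      -- computation of the iterated steps.
      F (steps (toℕ i) (pair zero h)) G.∙ F y′ ≡⟨ cong (λ w → F w G.∙ F y′) (el′-injective steps≈pair) ⟩
      F (pair i h) G.∙ F y′                   ∎
      where
      F-act : ∀ h y → F (act h y) G.≈ F₀ h G.∙ F y
      F-act h y with coordinates y
      ... | at i h′ = begin
        F (pair i (mul h h′))                     ≈⟨ split i (mul h h′) ⟩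
        F (pair i nothing) G.∙ F₀ (mul h h′)      ≈⟨ G.∙-congˡ (F₀-mul h h′) ⟩
        F (pair i nothing) G.∙ (F₀ h G.∙ F₀ h′)   ≈⟨ solve 3 (λ a b c → a ⊕ (b ⊕ c) ⊜ b ⊕ (a ⊕ c)) G.refl _ _ _ ⟩
        F₀ h G.∙ (F (pair i nothing) G.∙ F₀ h′)   ≈⟨ G.∙-congˡ (split i h′) ⟨
        F₀ h G.∙ F (pair i h′)                    ∎

      F-step : ∀ y → F (step y) G.≈ Fg G.∙ F y
      F-step y with coordinates y
      ... | at i h = F-next i h

      F-steps : ∀ k y → F (steps k y) G.≈ k ⋆ Fg G.∙ F y
      F-steps zero    y = G.sym (G.identityˡ _)
      F-steps (suc k) y = begin
        F (step (steps k y))        ≈⟨ F-step (steps k y) ⟩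
        Fg G.∙ F (steps k y)        ≈⟨ G.∙-congˡ (F-steps k y) ⟩
        Fg G.∙ (k ⋆ Fg G.∙ F y)     ≈⟨ G.assoc _ _ _ ⟨
        suc k ⋆ Fg G.∙ F y          ∎

      steps≈pair : el′ (steps (toℕ i) (pair zero h)) ≈ el′ (pair i h)
      steps≈pair = A.trans (el-steps (toℕ i) (pair zero h))
        (A.trans (A.∙-congˡ (A.trans (el-pair zero h) (A.identityˡ _))) (A.sym (el-pair i h)))

  -- The relations [gᵗab] = [gᵗa] + [b] for the relations [ab] = [a] + [b] of H,
  -- [gⁱ⁺¹x] = [gⁱ⁺¹] + [x], and [gⁱ⁺²uᵢ] = [gⁱ⁺¹uᵢ] + [g] for 0 ≤ i ≤ p.
  module ExtendedPresentation (H : Subgroup) (E : Extension H) (P : Presentation H)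
    (t : Fin (2 ℕ.+ Extension.p E)) (u : Fin (suc (Extension.p E)) → Maybe (Subgroup.X H)) where
    open Subgroup H
    open Extension E
    open Extended H E
    open Presentation P

    J′ : Set
    J′ = J ⊎ (Fin (suc p) × Maybe X)

    left′ : J′ → Maybe X′
    left′ (inj₁ j)            = pair t (left j)
    left′ (inj₂ (i , nothing)) = pair (suc i) (u i)
    left′ (inj₂ (i , just x))  = pair (suc i) nothing

    right′ : J′ → X′
    right′ (inj₁ j)            = inj₁ (right j)
    right′ (inj₂ (i , nothing)) = inj₂ (zero , nothing)
    right′ (inj₂ (i , just x))  = inj₁ x

    product′ : J′ → Maybe X′
    product′ (inj₁ j)            = pair t (product j)
    product′ (inj₂ (i , nothing)) = next (view (suc i)) (u i)
    product′ (inj₂ (i , just x))  = pair (suc i) (just x)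

    el-product′ : ∀ j → el′ (product′ j) ≈ el′ (left′ j) ∙ nonunit′ (right′ j)
    el-product′ (inj₁ j) =
      A.trans (el-pair t (product j)) (A.trans (A.∙-congˡ (el-product j))
      (A.trans (A.sym (A.assoc _ _ _)) (A.∙-congʳ (A.sym (el-pair t (left j))))))
    el-product′ (inj₂ (i , nothing)) =
      A.trans (el-next (view (suc i)) (u i)) (A.trans (A.comm _ _)
      (A.∙-congˡ (A.sym (A.trans (A.identityʳ _) (A.identityʳ _)))))
    el-product′ (inj₂ (i , just x)) = A.∙-congʳ (A.sym (A.identityʳ _))

    generates′ : ∀ (G : AbelianGroup a b) (let module G = AbelianGroup G)
                 (F : Maybe X′ → G.Carrier) → F nothing G.≈ G.ε →
                 (∀ j → F (product′ j) G.≈ F (left′ j) G.∙ F (just (right′ j))) →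
                 ∀ y y′ → F (mul′ y y′) G.≈ F y G.∙ F y′
    generates′ G F F-unit F-product = hom F₀-mul split F-next
      where
      module G = AbelianGroup G
      open HomFromSteps H E G F
      open import Algebra.Properties.Group G.group using (∙-cancelˡ; ∙-cancelʳ)
      open import Algebra.Solver.CommutativeMonoid G.commutativeMonoid using (solve; _⊜_; _⊕_)
      open import Relation.Binary.Reasoning.Setoid G.setoid

      split : ∀ i h → F (pair i h) G.≈ F (pair i nothing) G.∙ F₀ h
      split zero    h        = G.sym (G.trans (G.∙-congʳ F-unit) (G.identityˡ _))
      split (suc i) nothing  = G.sym (G.trans (G.∙-congˡ F-unit) (G.identityʳ _))
      split (suc i) (just x) = F-product (inj₂ (i , just x))

      F₀-mul : ∀ h h′ → F₀ (mul h h′) G.≈ F₀ h G.∙ F₀ h′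
      -- The shift by gᵗ splits off as the summand F(gᵗ) on both sides and cancels, which gives back
      -- the relations of H.
      F₀-mul = generates G F₀ F-unit λ j → ∙-cancelˡ (F (pair t nothing)) _ _ (begin
        F (pair t nothing) G.∙ F₀ (product j)                       ≈⟨ split t (product j) ⟨
        F (pair t (product j))                                      ≈⟨ F-product (inj₁ j) ⟩
        F (pair t (left j)) G.∙ F₀ (just (right j))                 ≈⟨ G.∙-congʳ (split t (left j)) ⟩
        F (pair t nothing) G.∙ F₀ (left j) G.∙ F₀ (just (right j))  ≈⟨ G.assoc _ _ _ ⟩
        F (pair t nothing) G.∙ (F₀ (left j) G.∙ F₀ (just (right j))) ∎)

      -- In other words, F(g · gⁱh) - F(h) is independent of h. At the wrap this rests on the
      -- additivity of F on H.
      next-shift : ∀ {i : Fin (2 ℕ.+ p)} (v : View i) h k →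
                   F (next v h) G.∙ F₀ k G.≈ F (next v k) G.∙ F₀ h
      next-shift ‵fromℕ h k = begin
        F₀ (mul z h) G.∙ F₀ k       ≈⟨ G.∙-congʳ (F₀-mul z h) ⟩
        F₀ z G.∙ F₀ h G.∙ F₀ k      ≈⟨ solve 3 (λ a b c → (a ⊕ b) ⊕ c ⊜ (a ⊕ c) ⊕ b) G.refl _ _ _ ⟩
        F₀ z G.∙ F₀ k G.∙ F₀ h      ≈⟨ G.∙-congʳ (F₀-mul z k) ⟨
        F₀ (mul z k) G.∙ F₀ h       ∎
      next-shift (‵inj₁ {i = i} _) h k = begin
        F (pair (suc i) h) G.∙ F₀ k                  ≈⟨ G.∙-congʳ (split (suc i) h) ⟩
        F (pair (suc i) nothing) G.∙ F₀ h G.∙ F₀ k   ≈⟨ solve 3 (λ a b c → (a ⊕ b) ⊕ c ⊜ (a ⊕ c) ⊕ b) G.refl _ _ _ ⟩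
        F (pair (suc i) nothing) G.∙ F₀ k G.∙ F₀ h   ≈⟨ G.∙-congʳ (split (suc i) k) ⟨
        F (pair (suc i) k) G.∙ F₀ h                  ∎

      F-next : ∀ i h → F (next (view i) h) G.≈ Fg G.∙ F (pair i h)
      F-next zero    h = split (suc zero) h
      -- Only the instance h = uᵢ is among the relations; `next-shift` carries it over to every h.
      F-next (suc i) h = ∙-cancelʳ (F₀ (u i)) _ _ (begin
        F (next (view (suc i)) h) G.∙ F₀ (u i)            ≈⟨ next-shift (view (suc i)) h (u i) ⟩
        F (next (view (suc i)) (u i)) G.∙ F₀ h            ≈⟨ G.∙-congʳ (F-product (inj₂ (i , nothing))) ⟩
        F (pair (suc i) (u i)) G.∙ Fg G.∙ F₀ h            ≈⟨ G.∙-congʳ (G.∙-congʳ (split (suc i) (u i))) ⟩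
        F (pair (suc i) nothing) G.∙ F₀ (u i) G.∙ Fg G.∙ F₀ h
          ≈⟨ solve 4 (λ a b c d → ((a ⊕ b) ⊕ c) ⊕ d ⊜ (c ⊕ (a ⊕ d)) ⊕ b) G.refl _ _ _ _ ⟩
        Fg G.∙ (F (pair (suc i) nothing) G.∙ F₀ h) G.∙ F₀ (u i) ≈⟨ G.∙-congʳ (G.∙-congˡ (split (suc i) h)) ⟨
        Fg G.∙ F (pair (suc i) h) G.∙ F₀ (u i)            ∎)

    defect′ : (Maybe X′ → ℤ) → J′ → ℤ
    defect′ d j = d (product′ j) ℤ.- d (left′ j) ℤ.- d (just (right′ j))

    onPairs : (Fin (2 ℕ.+ p) → Maybe X → ℤ) → Maybe X′ → ℤ
    onPairs φ nothing               = φ zero nothing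
    onPairs φ (just (inj₁ x))       = φ zero (just x)
    onPairs φ (just (inj₂ (i , h))) = φ (suc i) h

    onPairs-pair : ∀ φ i h → onPairs φ (pair i h) ≡ φ i h
    onPairs-pair φ zero    nothing  = refl
    onPairs-pair φ zero    (just x) = refl
    onPairs-pair φ (suc i) h        = refl

    M : ℤ
    M = + (2 ℕ.+ p)

    -- After scaling by the degree, d extends to a functional on the larger
    -- group that kills all new relations; the slope along g is forced by the
    -- relation gᵐ uₚ = gᵐ⁻¹ uₚ · g, where gᵐ = z.
    module Lift (d : Maybe X → ℤ) (d-unit : d nothing ≡ 0ℤ) where

      -- For additive d this would be d(z), as gᵐ = z demands. Since d need not be additive, the
      -- difference is taken at uₚ, where the wrapping relation tests it.
      slope : ℤ
      slope = d (mul z (u (fromℕ p))) ℤ.- d (u (fromℕ p))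

      φ : Fin (2 ℕ.+ p) → Maybe X → ℤ
      φ i h = + toℕ i ℤ.* slope ℤ.+ M ℤ.* d h

      lift : Maybe X′ → ℤ
      lift = onPairs φ

      lift-unit : lift nothing ≡ 0ℤ
      lift-unit = ≡.trans (cong (λ w → 0ℤ ℤ.* slope ℤ.+ M ℤ.* w) d-unit) (ring slope M)
        where
        ring : ∀ s m → 0ℤ ℤ.* s ℤ.+ m ℤ.* 0ℤ ≡ 0ℤ
        ring = solve-∀

      lift-old : ∀ j → defect′ lift (inj₁ j) ≡ M ℤ.* defect d j
      lift-old j
        rewrite onPairs-pair φ t (product j) | onPairs-pair φ t (left j) =
        ring (+ toℕ t) slope M (d (product j)) (d (left j)) (d (just (right j)))
        where
        ring : ∀ t s m x y w → (t ℤ.* s ℤ.+ m ℤ.* x) ℤ.- (t ℤ.* s ℤ.+ m ℤ.* y) ℤ.-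
               (0ℤ ℤ.* s ℤ.+ m ℤ.* w) ≡ m ℤ.* (x ℤ.- y ℤ.- w)
        ring = solve-∀

      -- The equation `i′ ≡ suc i` is kept apart from the view because `suc i` does not unify with
      -- `inject₁ k`.
      lift-next : ∀ {i} {i′ : Fin (2 ℕ.+ p)} (v : View i′) → i′ ≡ suc i →
                  lift (next v (u i)) ℤ.- φ (suc i) (u i) ℤ.- φ (suc zero) nothing ≡ 0ℤ
      lift-next ‵fromℕ refl
        rewrite onPairs-pair φ zero (mul z (u (fromℕ p))) | d-unit | Fin.toℕ-fromℕ p =
        ring (+ p) (d (mul z (u (fromℕ p)))) (d (u (fromℕ p)))
        where
        ring : ∀ p x y → (0ℤ ℤ.* (x ℤ.- y) ℤ.+ (1ℤ ℤ.+ (1ℤ ℤ.+ p)) ℤ.* x) ℤ.-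
               ((1ℤ ℤ.+ p) ℤ.* (x ℤ.- y) ℤ.+ (1ℤ ℤ.+ (1ℤ ℤ.+ p)) ℤ.* y) ℤ.-
               (1ℤ ℤ.* (x ℤ.- y) ℤ.+ (1ℤ ℤ.+ (1ℤ ℤ.+ p)) ℤ.* 0ℤ) ≡ 0ℤ
        ring = solve-∀
      lift-next {i} (‵inj₁ {i = k} _) eq
        rewrite ≡.trans (≡.sym (Fin.toℕ-inject₁ k)) (cong toℕ eq) | d-unit =
        ring (+ suc (toℕ i)) slope M (d (u i))
        where
        ring : ∀ i s m x → ((1ℤ ℤ.+ i) ℤ.* s ℤ.+ m ℤ.* x) ℤ.- (i ℤ.* s ℤ.+ m ℤ.* x) ℤ.-
               (1ℤ ℤ.* s ℤ.+ m ℤ.* 0ℤ) ≡ 0ℤ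
        ring = solve-∀

      lift-new : ∀ k → defect′ lift (inj₂ k) ≡ 0ℤ
      lift-new (i , nothing) = lift-next (view (suc i)) refl
      lift-new (i , just x) rewrite d-unit = ring (+ suc (toℕ i)) slope M (d (just x))
        where
        ring : ∀ i s m x → (i ℤ.* s ℤ.+ m ℤ.* x) ℤ.- (i ℤ.* s ℤ.+ m ℤ.* 0ℤ) ℤ.-
               (0ℤ ℤ.* s ℤ.+ m ℤ.* x) ≡ 0ℤ
        ring = solve-∀

    module Sawtooth (i : Fin (suc p)) where

      -- Falls by 1 at each exponent and jumps by M between i + 1 and i + 2. The jump makes up for
      -- the total fall, so ψ(M) = 0 = ψ(0) and ψ is consistent with the wrap; it violates only the
      -- relation that crosses the jump.
      ψ : ℕ → ℤ
      ψ k = M ℤ.* above (suc (toℕ i)) k ℤ.- + k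

      sawtooth : Maybe X′ → ℤ
      sawtooth = onPairs (λ j _ → ψ (toℕ j))

      ψ-0 : ψ 0 ≡ 0ℤ
      ψ-0 = cong (ℤ._- 0ℤ) (ℤ.*-zeroʳ M)

      ψ-1 : ψ 1 ≡ ℤ.- 1ℤ
      ψ-1 = cong (ℤ._- 1ℤ) (ℤ.*-zeroʳ M)

      sawtooth-split : ∀ j x → defect′ sawtooth (inj₂ (j , just x)) ≡ 0ℤ
      sawtooth-split j x = ≡.trans (cong (λ w → ψ (suc (toℕ j)) ℤ.- ψ (suc (toℕ j)) ℤ.- w) ψ-0)
                                   (ring (ψ (suc (toℕ j))))
        where
        ring : ∀ x → x ℤ.- x ℤ.- 0ℤ ≡ 0ℤ
        ring = solve-∀

      sawtooth-next : ∀ {j} {j′ : Fin (2 ℕ.+ p)} (v : View j′) h → j′ ≡ suc j →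
                      sawtooth (next v h) ℤ.- ψ (suc (toℕ j)) ℤ.- ψ 1 ≡
                      M ℤ.* (above (suc (toℕ i)) (2 ℕ.+ toℕ j) ℤ.-
                             above (suc (toℕ i)) (suc (toℕ j)))
      -- Here ψ(0) stands in for ψ(M); the two agree because the jump has been passed by exponent M,
      -- also for i = p.
      sawtooth-next ‵fromℕ h refl
        rewrite onPairs-pair (λ j _ → ψ (toℕ j)) zero (mul z h) | ψ-0 | ψ-1 | Fin.toℕ-fromℕ p
              | above-< (ℕ.s≤s (Fin.toℕ<n i)) =
        ring (+ p) (above (suc (toℕ i)) (suc p))
        where
        ring : ∀ p x → 0ℤ ℤ.- ((1ℤ ℤ.+ (1ℤ ℤ.+ p)) ℤ.* x ℤ.- (1ℤ ℤ.+ p)) ℤ.- ℤ.- 1ℤ ≡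
               (1ℤ ℤ.+ (1ℤ ℤ.+ p)) ℤ.* (1ℤ ℤ.- x)
        ring = solve-∀
      sawtooth-next {j} (‵inj₁ {i = k} _) h eq
        rewrite ≡.trans (≡.sym (Fin.toℕ-inject₁ k)) (cong toℕ eq) | ψ-1 =
        ring (+ suc (toℕ j)) M (above (suc (toℕ i)) (2 ℕ.+ toℕ j)) (above (suc (toℕ i)) (suc (toℕ j)))
        where
        ring : ∀ j m x y → (m ℤ.* x ℤ.- (1ℤ ℤ.+ j)) ℤ.- (m ℤ.* y ℤ.- j) ℤ.- ℤ.- 1ℤ ≡ m ℤ.* (x ℤ.- y)
        ring = solve-∀

      sawtooth-defect : ∀ j → defect′ sawtooth (inj₂ (j , nothing)) ≡
                        M ℤ.* (above (suc (toℕ i)) (2 ℕ.+ toℕ j) ℤ.-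
                               above (suc (toℕ i)) (suc (toℕ j)))
      sawtooth-defect j = sawtooth-next (view (suc j)) (u j) refl

      sawtooth-self : defect′ sawtooth (inj₂ (i , nothing)) ≢ 0ℤ
      sawtooth-self eq = +suc*≢0 (suc p) {1ℤ} (λ ()) (≡.trans (≡.sym (≡.trans (sawtooth-defect i)
        (cong (M ℤ.*_) (≡.cong₂ ℤ._-_ (above-< (ℕ.n<1+n (toℕ i))) (above-self (toℕ i)))))) eq)

      sawtooth-other : ∀ j → j ≢ i → defect′ sawtooth (inj₂ (j , nothing)) ≡ 0ℤ
      sawtooth-other j j≢i = ≡.trans (sawtooth-defect j)
        (≡.trans (cong (M ℤ.*_) (ℤ.i≡j⇒i-j≡0 (above-suc (j≢i ∘ Fin.toℕ-injective ∘ ℕ.suc-injective))))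
                 (ℤ.*-zeroʳ M))

    _≟X_ : DecidableEquality X
    _≟X_ = via-injection (↔⇒↣ (↔-sym elements)) Fin._≟_

    _≟_ : DecidableEquality (Fin (suc p) × X)
    _≟_ = ≡-dec Fin._≟_ _≟X_

    indicator : Fin (suc p) × X → Maybe X′ → ℤ
    indicator k (just (inj₂ (i , just x))) = if does ((i , x) ≟ k) then 1ℤ else 0ℤ
    indicator k _                          = 0ℤ

    indicator-self : ∀ i x → defect′ (indicator (i , x)) (inj₂ (i , just x)) ≢ 0ℤ
    indicator-self i x eq rewrite dec-true ((i , x) ≟ (i , x)) refl with () ← eq

    indicator-other : ∀ k i x → (i , x) ≢ k → defect′ (indicator k) (inj₂ (i , just x)) ≡ 0ℤ
    indicator-other k i x ≢k rewrite dec-false ((i , x) ≟ k) ≢k = refl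

    -- The order of elimination is triangular. Lifts vanish on all new relations, so the old ones go
    -- first. Sawtooths depend on the exponent only and kill the splitting relations. Indicators may
    -- be nonzero at gᵗ-shifted elements and at gⁱuᵢ, so they come when the old and the rising
    -- relations are already in Z.
    eliminates′ : ∀ (Z : J′ → Set) →
                  (∀ d j → d nothing ≡ 0ℤ → defect′ d j ≢ 0ℤ →
                   (∀ k → k ≢ j → Z k ⊎ defect′ d k ≡ 0ℤ) → Z j) →
                  ∀ j → Z j
    eliminates′ Z close = λ
      { (inj₁ j)             → old j
      ; (inj₂ (i , nothing)) → rising i
      ; (inj₂ (i , just x))  → splitting i x
      }
      where
      old : ∀ j → Z (inj₁ j)
      old = eliminates (Z ∘ inj₁) λ d j d-unit nonzero others →
        let open Lift d d-unit in
        close lift (inj₁ j) lift-unit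
          (λ eq → +suc*≢0 (suc p) nonzero (≡.trans (≡.sym (lift-old j)) eq))
          λ { (inj₁ k) k≢j → [ inj₁ , (λ eq → inj₂ (≡.trans (lift-old k)
                               (≡.trans (cong (M ℤ.*_) eq) (ℤ.*-zeroʳ M)))) ]′
                             (others k (k≢j ∘ cong inj₁))
            ; (inj₂ k) _   → inj₂ (lift-new k) }

      rising : ∀ i → Z (inj₂ (i , nothing))
      rising i = close sawtooth (inj₂ (i , nothing)) ψ-0 sawtooth-self
        λ { (inj₁ k)             _   → inj₁ (old k)
          ; (inj₂ (j , just x))  _   → inj₂ (sawtooth-split j x)
          ; (inj₂ (j , nothing)) j≢i → inj₂ (sawtooth-other j λ { refl → j≢i refl }) }
        where open Sawtooth i

      splitting : ∀ i x → Z (inj₂ (i , just x))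
      splitting i x = close (indicator (i , x)) (inj₂ (i , just x)) refl (indicator-self i x)
        λ { (inj₁ k)             _  → inj₁ (old k)
          ; (inj₂ (j , nothing)) _  → inj₁ (rising j)
          ; (inj₂ (j , just y))  ≢k → inj₂ (indicator-other (i , x) j y λ { refl → ≢k refl }) }

    extended-presentation : Presentation extended
    extended-presentation = record
      { J = J′ ; count = count ℕ.+ suc p ℕ.* suc size ; relations = Fin+*↔ relations elements
      ; left = left′ ; right = right′ ; product = product′ ; el-product = el-product′
      ; generates = generates′ ; eliminates = eliminates′
      }

    -- For positive t, the left factor and the product of an old or a splitting relation lie outside
    -- H, the right factor inside. For the remaining relations, the only possible coincidences are g
    -- u₀ = g and z uₚ = 1.
    extended-quadrilateral : ∀ {s} → t ≡ suc s → u zero ≢ nothing →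
                             mul z (u (fromℕ p)) ≢ nothing →
                             Presentation.Quadrilateral extended-presentation
    extended-quadrilateral refl _ _ (inj₁ j) = (λ ()) , (λ ()) , (λ ())
    extended-quadrilateral refl _ _ (inj₂ (i , just x)) = (λ ()) , (λ ()) , (λ ())
    extended-quadrilateral refl u₀≢ zuₚ≢ (inj₂ (i , nothing)) =
      (λ ()) , left≢right i , next≢nothing (view (suc i)) refl
      where
      left≢right : ∀ i → pair (suc i) (u i) ≢ just (inj₂ (zero , nothing))
      left≢right zero = u₀≢ ∘ cong λ { (just (inj₂ (_ , h))) → h ; _ → nothing }
      left≢right (suc i) ()

      pair-zero≢nothing : ∀ {h} → h ≢ nothing → pair zero h ≢ nothing
      pair-zero≢nothing {nothing} h≢ _ = h≢ refl

      next≢nothing : ∀ {i} {i′ : Fin (2 ℕ.+ p)} (v : View i′) → i′ ≡ suc i → next v (u i) ≢ nothing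
      next≢nothing ‵fromℕ   refl = pair-zero≢nothing zuₚ≢
      next≢nothing (‵inj₁ _) _  ()

-- Cyclic groups of order at least 5

module Cyclic {c ℓ} (A : AbelianGroup c ℓ) (a b : Level) where

  open AbelianGroup A using (Carrier; _≈_; _∙_; ε)
  private module A = AbelianGroup A
  open Algebra.Properties.Monoid.Mult A.monoid using (×-homo-+; ×-congˡ) renaming (_×_ to _⋆_)
  open Subgroups A
  open Presentations A a b

  -- For a cyclic group of order n = 5 + k: the relations g = gⁿ⁻¹ · g²,
  -- gⁿ⁻³ = gⁿ⁻² · gⁿ⁻¹ and gʲ⁺³ = gʲ⁺² · g for 0 ≤ j < n − 3.
  module CyclicPresentation
    (H : Subgroup) (only-unit : ¬ Subgroup.X H) (g : Carrier) (k : ℕ)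
    (order : ε ≈ (5 ℕ.+ k) ⋆ g)
    (minimal : ∀ (i : Fin (4 ℕ.+ k)) y → ¬ Subgroup.el H y ≈ suc (toℕ i) ⋆ g)
    where
    open Subgroup H

    E : Extension H
    E = record { g = g ; p = 3 ℕ.+ k ; z = nothing ; el-z = order ; minimal = minimal }

    open Extended H E

    power : Fin (5 ℕ.+ k) → Maybe X′
    power i = pair i nothing

    -- Of the n - 1 relations gʲ⁺¹ = gʲ · g with 0 < j < n, the first has equal factors and the last
    -- has product 1. The indices `nothing` and `just nothing` stand for their replacements, which
    -- would coincide for n = 4.
    J : Set
    J = Maybe (Maybe (Fin (2 ℕ.+ k)))

    left : J → Maybe X′
    left nothing         = power (fromℕ (4 ℕ.+ k))
    left (just nothing)  = power (inject₁ (fromℕ (3 ℕ.+ k)))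
    left (just (just j)) = power (suc (suc (inject₁ j)))

    rightExponent : J → Fin (4 ℕ.+ k)
    rightExponent nothing         = suc zero
    rightExponent (just nothing)  = fromℕ (3 ℕ.+ k)
    rightExponent (just (just j)) = zero

    right : J → X′
    right j = inj₂ (rightExponent j , nothing)

    product : J → Maybe X′
    product nothing         = power (suc zero)
    product (just nothing)  = power (inject₁ (inject₁ (fromℕ (2 ℕ.+ k))))
    product (just (just j)) = power (suc (suc (suc j)))

    el-power : ∀ i → el′ (power i) ≈ toℕ i ⋆ g
    el-power i = A.trans (el-pair i nothing) (A.identityʳ _)

    toℕ-n-2 : toℕ (inject₁ (fromℕ (3 ℕ.+ k))) ≡ 3 ℕ.+ k
    toℕ-n-2 = ≡.trans (Fin.toℕ-inject₁ _) (Fin.toℕ-fromℕ _)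

    toℕ-n-3 : toℕ (inject₁ (inject₁ (fromℕ (2 ℕ.+ k)))) ≡ 2 ℕ.+ k
    toℕ-n-3 = ≡.trans (Fin.toℕ-inject₁ _) (≡.trans (Fin.toℕ-inject₁ _) (Fin.toℕ-fromℕ _))

    power-∙ : ∀ l m n → toℕ l ℕ.+ toℕ m ≡ toℕ n → el′ (power n) ≈ el′ (power l) ∙ el′ (power m)
    power-∙ l m n eq =
      A.trans (el-power n) (A.trans (×-congˡ (≡.sym eq)) (A.trans (×-homo-+ g (toℕ l) (toℕ m))
      (A.∙-cong (A.sym (el-power l)) (A.sym (el-power m)))))

    power-∙-wrap : ∀ l m n → toℕ l ℕ.+ toℕ m ≡ (5 ℕ.+ k) ℕ.+ toℕ n →
                   el′ (power n) ≈ el′ (power l) ∙ el′ (power m)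
    power-∙-wrap l m n eq =
      A.trans (el-power n) (A.trans (A.sym (A.identityˡ _)) (A.trans (A.∙-congʳ order)
      (A.trans (A.sym (×-homo-+ g (5 ℕ.+ k) (toℕ n))) (A.trans (×-congˡ (≡.sym eq))
      (A.trans (×-homo-+ g (toℕ l) (toℕ m)) (A.∙-cong (A.sym (el-power l)) (A.sym (el-power m))))))))

    el-product : ∀ j → el′ (product j) ≈ el′ (left j) ∙ nonunit′ (right j)
    el-product nothing = power-∙-wrap (fromℕ (4 ℕ.+ k)) (suc (suc zero)) (suc zero)
      (≡.trans (cong (ℕ._+ 2) (Fin.toℕ-fromℕ (4 ℕ.+ k))) (eq k))
      where
      eq : ∀ k → 4 ℕ.+ k ℕ.+ 2 ≡ 5 ℕ.+ k ℕ.+ 1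
      eq = ℕ-Solver.solve-∀
    el-product (just nothing) = power-∙-wrap (inject₁ (fromℕ (3 ℕ.+ k))) (suc (fromℕ (3 ℕ.+ k)))
      (inject₁ (inject₁ (fromℕ (2 ℕ.+ k))))
      (≡.trans (≡.cong₂ ℕ._+_ toℕ-n-2 (cong suc (Fin.toℕ-fromℕ (3 ℕ.+ k))))
      (≡.trans (eq k) (cong (5 ℕ.+ k ℕ.+_) (≡.sym toℕ-n-3))))
      where
      eq : ∀ k → 3 ℕ.+ k ℕ.+ (4 ℕ.+ k) ≡ 5 ℕ.+ k ℕ.+ (2 ℕ.+ k)
      eq = ℕ-Solver.solve-∀
    el-product (just (just j)) = power-∙ (suc (suc (inject₁ j))) (suc zero) (suc (suc (suc j)))
      (≡.trans (cong (λ n → 2 ℕ.+ n ℕ.+ 1) (Fin.toℕ-inject₁ j)) (ℕ.+-comm (2 ℕ.+ toℕ j) 1))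

    unique : ∀ (h : Maybe X) → h ≡ nothing
    unique nothing  = refl
    unique (just x) = contradiction x only-unit

    generates : ∀ (G : AbelianGroup a b) (let module G = AbelianGroup G)
                (F : Maybe X′ → G.Carrier) → F nothing G.≈ G.ε →
                (∀ j → F (product j) G.≈ F (left j) G.∙ F (just (right j))) →
                ∀ y y′ → F (mul′ y y′) G.≈ F y G.∙ F y′
    generates G F F-unit F-product = hom F₀-mul split (λ i → F-next (view i))
      where
      module G = AbelianGroup G
      open HomFromSteps H E G F
      open import Algebra.Properties.Group G.group using (∙-cancelˡ)
      open import Relation.Binary.Reasoning.Setoid G.setoid

      F₀-unit : ∀ h → F₀ h G.≈ G.ε
      F₀-unit h = ≡.subst (λ h → F₀ h G.≈ G.ε) (≡.sym (unique h)) F-unit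

      F₀-mul : ∀ h h′ → F₀ (mul h h′) G.≈ F₀ h G.∙ F₀ h′
      F₀-mul h h′ = G.trans (F₀-unit (mul h h′))
        (G.sym (G.trans (G.∙-cong (F₀-unit h) (F₀-unit h′)) (G.identityˡ _)))

      split : ∀ i h → F (pair i h) G.≈ F (pair i nothing) G.∙ F₀ h
      split i h with refl ← unique h = G.sym (G.trans (G.∙-congˡ F-unit) (G.identityʳ _))

      Fₙ₋₁ Fₙ₋₂ Fₙ₋₃ : G.Carrier
      Fₙ₋₁ = F (power (fromℕ (4 ℕ.+ k)))
      Fₙ₋₂ = F (power (inject₁ (fromℕ (3 ℕ.+ k))))
      Fₙ₋₃ = F (power (inject₁ (inject₁ (fromℕ (2 ℕ.+ k)))))

      -- Recovers the omitted relation gⁿ⁻¹ · g = 1: substituting gⁿ⁻² = gⁿ⁻³ · g into gⁿ⁻³ = gⁿ⁻² ·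
      -- gⁿ⁻¹ lets F(gⁿ⁻³) cancel.
      F-top : G.ε G.≈ Fg G.∙ Fₙ₋₁
      F-top = ∙-cancelˡ Fₙ₋₃ _ _ (begin
        Fₙ₋₃ G.∙ G.ε             ≈⟨ G.identityʳ _ ⟩
        Fₙ₋₃                     ≈⟨ F-product (just nothing) ⟩
        Fₙ₋₂ G.∙ Fₙ₋₁            ≈⟨ G.∙-congʳ (F-product (just (just (inject₁ (fromℕ k))))) ⟩
        Fₙ₋₃ G.∙ Fg G.∙ Fₙ₋₁     ≈⟨ G.assoc _ _ _ ⟩
        Fₙ₋₃ G.∙ (Fg G.∙ Fₙ₋₁)   ∎)

      -- Recovers the omitted relation g · g = g² from g = gⁿ⁻¹ · g², as F(gⁿ⁻¹) is now the inverse
      -- of F(g).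
      F-square : F (power (suc (suc zero))) G.≈ Fg G.∙ Fg
      F-square = begin
        F²                       ≈⟨ G.identityˡ _ ⟨
        G.ε G.∙ F²               ≈⟨ G.∙-congʳ F-top ⟩
        Fg G.∙ Fₙ₋₁ G.∙ F²       ≈⟨ G.assoc _ _ _ ⟩
        Fg G.∙ (Fₙ₋₁ G.∙ F²)     ≈⟨ G.∙-congˡ (F-product nothing) ⟨
        Fg G.∙ Fg                ∎
        where F² = F (power (suc (suc zero)))

      F-next : ∀ {i} (v : View i) h → F (next v h) G.≈ Fg G.∙ F (pair i h)
      F-next v h with refl ← unique h = go v
        where
        go : ∀ {i} (v : View i) → F (next v nothing) G.≈ Fg G.∙ F (power i)
        go ‵fromℕ = G.trans (F₀-unit (mul nothing nothing)) F-top
        go (‵inj₁ {i = zero} _)        = G.sym (G.trans (G.∙-congˡ F-unit) (G.identityʳ _))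
        go (‵inj₁ {i = suc zero} _)    = F-square
        go (‵inj₁ {i = suc (suc j)} _) = G.trans (F-product (just (just j))) (G.comm _ _)

    defect : (Maybe X′ → ℤ) → J → ℤ
    defect d j = d (product j) ℤ.- d (left j) ℤ.- d (just (right j))

    onExponents : (ℕ → ℤ) → Maybe X′ → ℤ
    onExponents f (just (inj₂ (i , _))) = f (suc (toℕ i))
    onExponents f _                     = f 0

    module _ (f : ℕ → ℤ) where

      onExponents-power : ∀ i → onExponents f (power i) ≡ f (toℕ i)
      onExponents-power zero    = refl
      onExponents-power (suc i) = refl

      defect-first : defect (onExponents f) nothing ≡ f 1 ℤ.- f (4 ℕ.+ k) ℤ.- f 2
      defect-first = cong (λ n → f 1 ℤ.- f n ℤ.- f 2) (Fin.toℕ-fromℕ (4 ℕ.+ k))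

      defect-second : defect (onExponents f) (just nothing) ≡ f (2 ℕ.+ k) ℤ.- f (3 ℕ.+ k) ℤ.- f (4 ℕ.+ k)
      defect-second = ≡.cong₂ ℤ._-_
        (≡.cong₂ ℤ._-_ (cong f toℕ-n-3) (cong f toℕ-n-2))
        (cong f (Fin.toℕ-fromℕ (4 ℕ.+ k)))

      defect-rest : ∀ j → defect (onExponents f) (just (just j)) ≡
                    f (3 ℕ.+ toℕ j) ℤ.- f (2 ℕ.+ toℕ j) ℤ.- f 1
      defect-rest j = cong (λ n → f (3 ℕ.+ toℕ j) ℤ.- f (2 ℕ.+ n) ℤ.- f 1) (Fin.toℕ-inject₁ j)

    n : ℤ
    n = + (5 ℕ.+ k)

    -- The relations gʲ⁺³ = gʲ⁺² · g force f(j) = s j + c for j ≥ 2, where s = f(1). The second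
    -- relation then has defect -(c + s n). It vanishes for `f₁`, with s = 1 and c = -n, and is -n
    -- for `f₂`, with s = 2 and c = -n. The first relation has defect n under `f₁`.
    f₁ f₂ : ℕ → ℤ
    f₁ 0             = 0ℤ
    f₁ 1             = 1ℤ
    f₁ (suc (suc j)) = + (2 ℕ.+ j) ℤ.- n
    f₂ 0             = 0ℤ
    f₂ 1             = + 2
    f₂ (suc (suc j)) = + 2 ℤ.* + (2 ℕ.+ j) ℤ.- n

    eliminates : ∀ (Z : J → Set) →
                 (∀ d j → d nothing ≡ 0ℤ → defect d j ≢ 0ℤ →
                  (∀ k → k ≢ j → Z k ⊎ defect d k ≡ 0ℤ) → Z j) →
                 ∀ j → Z j
    eliminates Z close = λ
      { nothing         → first
      ; (just nothing)  → second
      ; (just (just i)) → rest i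
      }
      where
      first : Z nothing
      first = close (onExponents f₁) nothing refl
        (λ eq → case ≡.trans (≡.sym (≡.trans (defect-first f₁) (ring₁ (+ k)))) eq of λ ())
        λ { nothing         ≢ → contradiction refl ≢
          ; (just nothing)  _ → inj₂ (≡.trans (defect-second f₁) (ring₂ (+ k)))
          ; (just (just j)) _ → inj₂ (≡.trans (defect-rest f₁ j) (ring₃ (+ k) (+ toℕ j))) }
        where
        ring₁ : ∀ k → 1ℤ ℤ.- (+ 4 ℤ.+ k ℤ.- (+ 5 ℤ.+ k)) ℤ.- (+ 2 ℤ.- (+ 5 ℤ.+ k)) ≡ + 5 ℤ.+ k
        ring₁ = solve-∀
        ring₂ : ∀ k → (+ 2 ℤ.+ k ℤ.- (+ 5 ℤ.+ k)) ℤ.- (+ 3 ℤ.+ k ℤ.- (+ 5 ℤ.+ k)) ℤ.-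
                      (+ 4 ℤ.+ k ℤ.- (+ 5 ℤ.+ k)) ≡ 0ℤ
        ring₂ = solve-∀
        ring₃ : ∀ k j → (+ 3 ℤ.+ j ℤ.- (+ 5 ℤ.+ k)) ℤ.- (+ 2 ℤ.+ j ℤ.- (+ 5 ℤ.+ k)) ℤ.- 1ℤ ≡ 0ℤ
        ring₃ = solve-∀

      second : Z (just nothing)
      second = close (onExponents f₂) (just nothing) refl
        (λ eq → case ≡.trans (≡.sym (≡.trans (defect-second f₂) (ring₂ (+ k)))) eq of λ ())
        λ { nothing         _ → inj₁ first
          ; (just nothing)  ≢ → contradiction refl ≢
          ; (just (just j)) _ → inj₂ (≡.trans (defect-rest f₂ j) (ring₃ (+ k) (+ toℕ j))) }
        where
        ring₂ : ∀ k → (+ 2 ℤ.* (+ 2 ℤ.+ k) ℤ.- (+ 5 ℤ.+ k)) ℤ.- (+ 2 ℤ.* (+ 3 ℤ.+ k) ℤ.- (+ 5 ℤ.+ k)) ℤ.-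
                      (+ 2 ℤ.* (+ 4 ℤ.+ k) ℤ.- (+ 5 ℤ.+ k)) ≡ ℤ.- (+ 5 ℤ.+ k)
        ring₂ = solve-∀
        ring₃ : ∀ k j → (+ 2 ℤ.* (+ 3 ℤ.+ j) ℤ.- (+ 5 ℤ.+ k)) ℤ.-
                        (+ 2 ℤ.* (+ 2 ℤ.+ j) ℤ.- (+ 5 ℤ.+ k)) ℤ.- + 2 ≡ 0ℤ
        ring₃ = solve-∀

      rest : ∀ i → Z (just (just i))
      -- The jump lies between exponents i + 2 and i + 3, and f(1) = 0, so no other relation of this
      -- kind is violated.
      rest i = close (onExponents (above (2 ℕ.+ toℕ i))) (just (just i)) refl
        (λ eq → case ≡.trans (≡.sym (≡.trans (defect-rest (above (2 ℕ.+ toℕ i)) i)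
          (cong (ℤ._- 0ℤ) (≡.cong₂ ℤ._-_ (above-< (ℕ.n<1+n (toℕ i))) (above-self (toℕ i)))))) eq of λ ())
        λ { nothing         _ → inj₁ first
          ; (just nothing)  _ → inj₁ second
          ; (just (just j)) ≢ → inj₂ (≡.trans (defect-rest (above (2 ℕ.+ toℕ i)) j)
              (cong (ℤ._- 0ℤ) (ℤ.i≡j⇒i-j≡0 (above-suc λ eq → ≢ (cong (just ∘ just) (Fin.toℕ-injective eq)))))) }

    cyclic-presentation : Presentation extended
    cyclic-presentation = record
      { J = J ; count = 4 ℕ.+ k ; relations = Fin-suc↔Maybe (Fin-suc↔Maybe ↔-refl)
      ; left = left ; right = right ; product = product ; el-product = el-product
      ; generates = generates ; eliminates = eliminates
      }

    cyclic-quadrilateral : Presentation.Quadrilateral cyclic-presentation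
    cyclic-quadrilateral nothing = (λ ()) , (λ ()) , (λ ())
    cyclic-quadrilateral (just nothing) =
      (λ ()) , (λ eq → Fin.fromℕ≢inject₁ (≡.sym (exponent eq))) , (λ ())
      where
      exponent : ∀ {i j : Fin (4 ℕ.+ k)} →
                 just (inj₂ {A = X} (i , nothing {A = X})) ≡ just (inj₂ (j , nothing)) → i ≡ j
      exponent refl = refl
    cyclic-quadrilateral (just (just j)) = (λ ()) , (λ ()) , (λ ())

-- Sums of integer vectors

sum-zero : ∀ {n} (t : Vector ℤ n) → (∀ i → t i ≡ 0ℤ) → sumℤ t ≡ 0ℤ
sum-zero {n} t t≡0 = ≡.trans (sum-cong-≗ t≡0) (sum-replicate-zero n)

sum-single : ∀ {n} (t : Vector ℤ n) i → (∀ k → k ≢ i → t k ≡ 0ℤ) → sumℤ t ≡ t i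
sum-single {suc n} t i t≡0 = ≡.trans (sum-remove {i = i} t)
  (≡.trans (cong (λ w → t i ℤ.+ w) (sum-zero (removeAt t i) λ k → t≡0 _ (Fin.punchInᵢ≢i i k)))
           (ℤ.+-identityʳ (t i)))

sum-distrib-- : ∀ {n} (s t : Vector ℤ n) → sumℤ (λ i → s i ℤ.- t i) ≡ sumℤ s ℤ.- sumℤ t
sum-distrib-- {zero}  s t = refl
sum-distrib-- {suc n} s t = ≡.trans
  (cong (λ w → s zero ℤ.- t zero ℤ.+ w) (sum-distrib-- (s ∘ suc) (t ∘ suc)))
  (ring (s zero) (t zero) _ _)
  where
  ring : ∀ a b c d → a ℤ.- b ℤ.+ (c ℤ.- d) ≡ a ℤ.+ c ℤ.- (b ℤ.+ d)
  ring = solve-∀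

-- From a presentation to a lattice basis

module Lattice {c ℓ} (FA : FiniteAbelianGroup c ℓ) where
  open FiniteAbelianGroup FA using (enumeration; element; index) renaming (abelianGroup to A)
  open AbelianGroup A using (Carrier; _∙_; _⁻¹; ε) renaming (_≈_ to _≈ᴬ_)
  private module A = AbelianGroup A
  open Algebra.Properties.AbelianGroup A
    using (identityʳ-unique; identityˡ-unique; ε⁻¹≈ε; \\-leftDividesˡ; \\-leftDividesʳ)
  open GroupRing FA
  open Subgroups A
  open Presentations A c c

  Congruent : (Carrier → ℤ) → Set (c ⊔ ℓ)
  Congruent f = ∀ {a b} → a ≈ᴬ b → f a ≡ f b

  ∑-cong : ∀ {f h : Carrier → ℤ} → (∀ a → f a ≡ h a) → ∑ f ≡ ∑ h
  ∑-cong f≡h = sum-cong-≗ λ i → f≡h (element i)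

  ∑-distrib-- : ∀ (f h : Carrier → ℤ) → ∑ (λ a → f a ℤ.- h a) ≡ ∑ f ℤ.- ∑ h
  ∑-distrib-- f h = sum-distrib-- (f ∘ element) (h ∘ element)

  *-distribˡ-∑ : ∀ k (f : Carrier → ℤ) → k ℤ.* ∑ f ≡ ∑ (λ a → k ℤ.* f a)
  *-distribˡ-∑ k f = *-distribˡ-sum k (f ∘ element)

  *-distribʳ-∑ : ∀ k (f : Carrier → ℤ) → ∑ f ℤ.* k ≡ ∑ (λ a → f a ℤ.* k)
  *-distribʳ-∑ k f = *-distribʳ-sum k (f ∘ element)

  index-injective : ∀ {a b} → index a ≡ index b → a ≈ᴬ b
  index-injective {a} {b} eq = A.trans (A.sym (Inverse.strictlyInverseˡ enumeration a))
    (A.trans (A.reflexive (cong element eq)) (Inverse.strictlyInverseˡ enumeration b))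

  -- The common source of congruence, symmetry and translation of the coefficients: each is an
  -- equivalence of equations in A.
  ι-⇔ : ∀ {a b a′ b′} → (a ≈ᴬ b) ⇔ (a′ ≈ᴬ b′) → ι a ⟦ b ⟧ ≡ ι a′ ⟦ b′ ⟧
  ι-⇔ {a} {b} {a′} {b′} eqv = cong (if_then 1ℤ else 0ℤ) (does-⇔
    (mk⇔ (Inverse.from-cong enumeration ∘ Equivalence.to eqv ∘ index-injective)
         (Inverse.from-cong enumeration ∘ Equivalence.from eqv ∘ index-injective))
    (index a Fin.≟ index b) (index a′ Fin.≟ index b′))

  ι-congˡ : ∀ {a b} → a ≈ᴬ b → ∀ g → ι a ⟦ g ⟧ ≡ ι b ⟦ g ⟧
  ι-congˡ a≈b g = ι-⇔ (mk⇔ (A.trans (A.sym a≈b)) (A.trans a≈b))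

  ι-true : ∀ {a b} → a ≈ᴬ b → ι a ⟦ b ⟧ ≡ 1ℤ
  ι-true a≈b = cong (if_then 1ℤ else 0ℤ) (dec-true (_ Fin.≟ _) (Inverse.from-cong enumeration a≈b))

  ι-false : ∀ {a b} → ¬ a ≈ᴬ b → ι a ⟦ b ⟧ ≡ 0ℤ
  ι-false {a} {b} a≉b = cong (if_then 1ℤ else 0ℤ)
    (dec-false (_ Fin.≟ _) (a≉b ∘ index-injective))

  ∑-ι : ∀ f → Congruent f → ∀ a → ∑ (λ g → f g ℤ.* ι a ⟦ g ⟧) ≡ f a
  ∑-ι f f-cong a = ≡.trans (sum-single (λ i → f (element i) ℤ.* ι a ⟦ element i ⟧) (index a) λ k k≢ → ≡.trans
      (cong (f (element k) ℤ.*_) (ι-false λ a≈ → k≢ (≡.sym (≡.trans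
        (Inverse.from-cong enumeration a≈) (Inverse.strictlyInverseʳ enumeration k)))))
      (ℤ.*-zeroʳ (f (element k))))
    (≡.trans (≡.cong₂ ℤ._*_ (f-cong a′≈a) (ι-true (A.sym a′≈a))) (ℤ.*-identityʳ (f a)))
    where
    a′≈a : element (index a) ≈ᴬ a
    a′≈a = Inverse.strictlyInverseˡ enumeration a

  ∑-ιʳ : ∀ f → Congruent f → ∀ h → ∑ (λ g → f g ℤ.* ι g ⟦ h ⟧) ≡ f h
  ∑-ιʳ f f-cong h = ≡.trans
    (∑-cong λ g → cong (f g ℤ.*_) (ι-⇔ {g} {h} {h} {g} (mk⇔ A.sym A.sym)))
    (∑-ι f f-cong h)

  -- The coefficient of g in (a - 1)(b - 1), grouped as a(b - 1) - (b - 1), the form in which the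
  -- convolution yields it.
  q : Carrier → Carrier → Carrier → ℤ
  q a b g = ι (a ∙ b) ⟦ g ⟧ ℤ.- ι a ⟦ g ⟧ ℤ.- (ι b ⟦ g ⟧ ℤ.- ι ε ⟦ g ⟧)

  ι-shift : ∀ a b g → ι b ⟦ a ⁻¹ ∙ g ⟧ ≡ ι (a ∙ b) ⟦ g ⟧
  ι-shift a b g = ι-⇔ (mk⇔
    (λ b≈ → A.trans (A.∙-congˡ b≈) (\\-leftDividesˡ a g))
    (λ ab≈g → A.trans (A.sym (\\-leftDividesʳ a b)) (A.∙-congˡ ab≈g)))

  product-form : ∀ a b g → ((ι a - 1#) * (ι b - 1#)) ⟦ g ⟧ ≡ q a b g
  product-form a b g = begin
    ∑ (λ x → (ι a ⟦ x ⟧ ℤ.- ι ε ⟦ x ⟧) ℤ.* y x)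
      ≡⟨ ∑-cong (λ x → ring (ι a ⟦ x ⟧) (ι ε ⟦ x ⟧) (y x)) ⟩
    ∑ (λ x → y x ℤ.* ι a ⟦ x ⟧ ℤ.- y x ℤ.* ι ε ⟦ x ⟧)
      ≡⟨ ∑-distrib-- (λ x → y x ℤ.* ι a ⟦ x ⟧) (λ x → y x ℤ.* ι ε ⟦ x ⟧) ⟩
    ∑ (λ x → y x ℤ.* ι a ⟦ x ⟧) ℤ.- ∑ (λ x → y x ℤ.* ι ε ⟦ x ⟧)
      ≡⟨ ≡.cong₂ ℤ._-_ (∑-ι y y-cong a) (∑-ι y y-cong ε) ⟩
    y a ℤ.- y ε
      ≡⟨ ≡.cong₂ ℤ._-_
           (≡.cong₂ ℤ._-_ (ι-shift a b g) (≡.trans (ι-shift a ε g) (ι-congˡ (A.identityʳ a) g)))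
           (≡.cong₂ ℤ._-_ (Func.cong (ι b) ε⁻¹g≈g) (Func.cong (ι ε) ε⁻¹g≈g)) ⟩
    q a b g ∎
    where
    open ≡.≡-Reasoning
    y : Carrier → ℤ
    y x = (ι b - 1#) ⟦ x ⁻¹ ∙ g ⟧
    y-cong : Congruent y
    y-cong eq = Func.cong (ι b - 1#) (A.∙-congʳ (A.⁻¹-cong eq))
    ε⁻¹g≈g : ε ⁻¹ ∙ g ≈ᴬ g
    ε⁻¹g≈g = A.trans (A.∙-congʳ ε⁻¹≈ε) (A.identityˡ g)
    ring : ∀ a e y → (a ℤ.- e) ℤ.* y ≡ y ℤ.* a ℤ.- y ℤ.* e
    ring = solve-∀

  ∑-four : ∀ (f x₁ x₂ x₃ x₄ : Carrier → ℤ) →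
    ∑ (λ g → f g ℤ.* (x₁ g ℤ.- x₂ g ℤ.- (x₃ g ℤ.- x₄ g))) ≡
    ∑ (λ g → f g ℤ.* x₁ g) ℤ.- ∑ (λ g → f g ℤ.* x₂ g) ℤ.-
    (∑ (λ g → f g ℤ.* x₃ g) ℤ.- ∑ (λ g → f g ℤ.* x₄ g))
  ∑-four f x₁ x₂ x₃ x₄ = ≡.trans
    (∑-cong λ g → ring (f g) (x₁ g) (x₂ g) (x₃ g) (x₄ g))
    (≡.trans (∑-distrib-- (λ g → f·₁ g ℤ.- f·₂ g) (λ g → f·₃ g ℤ.- f·₄ g))
             (≡.cong₂ ℤ._-_ (∑-distrib-- f·₁ f·₂) (∑-distrib-- f·₃ f·₄)))
    where
    f·₁ f·₂ f·₃ f·₄ : Carrier → ℤ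
    f·₁ g = f g ℤ.* x₁ g
    f·₂ g = f g ℤ.* x₂ g
    f·₃ g = f g ℤ.* x₃ g
    f·₄ g = f g ℤ.* x₄ g
    ring : ∀ f a b c d → f ℤ.* (a ℤ.- b ℤ.- (c ℤ.- d)) ≡
           f ℤ.* a ℤ.- f ℤ.* b ℤ.- (f ℤ.* c ℤ.- f ℤ.* d)
    ring = solve-∀

  ∑-q : ∀ f → Congruent f → ∀ a b →
        ∑ (λ g → f g ℤ.* q a b g) ≡ f (a ∙ b) ℤ.- f a ℤ.- (f b ℤ.- f ε)
  ∑-q f f-cong a b = ≡.trans (∑-four f (ι (a ∙ b) ⟦_⟧) (ι a ⟦_⟧) (ι b ⟦_⟧) (ι ε ⟦_⟧))
    (≡.cong₂ ℤ._-_ (≡.cong₂ ℤ._-_ (∑-ι f f-cong (a ∙ b)) (∑-ι f f-cong a))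
                   (≡.cong₂ ℤ._-_ (∑-ι f f-cong b) (∑-ι f f-cong ε)))

  ι-1#∈Δ : ∀ a → ι a - 1# ∈ Δ
  ι-1#∈Δ a = ≡.trans (∑-distrib-- (ι a ⟦_⟧) (ι ε ⟦_⟧))
    (ℤ.i≡j⇒i-j≡0 (≡.trans (∑ι≡1 a) (≡.sym (∑ι≡1 ε))))
    where
    ∑ι≡1 : ∀ a → ∑ (ι a ⟦_⟧) ≡ 1ℤ
    ∑ι≡1 a = ≡.trans (∑-cong λ g → ≡.sym (ℤ.*-identityˡ (ι a ⟦ g ⟧)))
                     (∑-ι (λ _ → 1ℤ) (λ _ → refl) a)

  -- As the coefficients of x and those of y sum to 0, each a may be replaced by a - 1 and each b by
  -- b - 1 in the expansion of xy; so products of augmentation elements are combinations of the (a -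
  -- 1)(b - 1).
  Δ-product : ∀ x y → x ∈ Δ → y ∈ Δ → ∀ g →
    (x * y) ⟦ g ⟧ ≡ ∑ (λ a → x ⟦ a ⟧ ℤ.* ∑ (λ b → y ⟦ b ⟧ ℤ.* q a b g))
  Δ-product x y x∈Δ y∈Δ g = ≡.sym (begin
    ∑ (λ a → x ⟦ a ⟧ ℤ.* ∑ (λ b → y ⟦ b ⟧ ℤ.* q a b g))
      ≡⟨ ∑-cong (λ a → ≡.trans (cong (x ⟦ a ⟧ ℤ.*_) (inner a))
           (ring (x ⟦ a ⟧) (y ⟦ a ⁻¹ ∙ g ⟧) (y ⟦ g ⟧))) ⟩
    ∑ (λ a → x ⟦ a ⟧ ℤ.* y ⟦ a ⁻¹ ∙ g ⟧ ℤ.- x ⟦ a ⟧ ℤ.* y ⟦ g ⟧)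
      ≡⟨ ∑-distrib-- (λ a → x ⟦ a ⟧ ℤ.* y ⟦ a ⁻¹ ∙ g ⟧) (λ a → x ⟦ a ⟧ ℤ.* y ⟦ g ⟧) ⟩
    (x * y) ⟦ g ⟧ ℤ.- ∑ (λ a → x ⟦ a ⟧ ℤ.* y ⟦ g ⟧)
      ≡⟨ cong (λ k → (x * y) ⟦ g ⟧ ℤ.- k) (Δ-* x x∈Δ (y ⟦ g ⟧)) ⟩
    (x * y) ⟦ g ⟧ ℤ.- 0ℤ                                            ≡⟨ ℤ.+-identityʳ _ ⟩
    (x * y) ⟦ g ⟧                                                   ∎)
    where
    open ≡.≡-Reasoning
    Δ-* : ∀ x → x ∈ Δ → ∀ k → ∑ (λ a → x ⟦ a ⟧ ℤ.* k) ≡ 0ℤ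
    Δ-* x x∈Δ k = ≡.trans (≡.sym (*-distribʳ-∑ k (x ⟦_⟧))) (cong (ℤ._* k) x∈Δ)
    ring : ∀ x a b → x ℤ.* (a ℤ.- 0ℤ ℤ.- (b ℤ.- 0ℤ)) ≡ x ℤ.* a ℤ.- x ℤ.* b
    ring = solve-∀
    inner : ∀ a → ∑ (λ b → y ⟦ b ⟧ ℤ.* q a b g) ≡ y ⟦ a ⁻¹ ∙ g ⟧ ℤ.- 0ℤ ℤ.- (y ⟦ g ⟧ ℤ.- 0ℤ)
    inner a = ≡.trans
      (∑-four (y ⟦_⟧) (λ b → ι (a ∙ b) ⟦ g ⟧) (λ _ → ι a ⟦ g ⟧) (λ b → ι b ⟦ g ⟧) (λ _ → ι ε ⟦ g ⟧))
      (≡.cong₂ ℤ._-_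
        (≡.cong₂ ℤ._-_
          (≡.trans (∑-cong λ b → cong (y ⟦ b ⟧ ℤ.*_) (≡.sym (ι-shift a b g)))
                   (∑-ιʳ (y ⟦_⟧) (Func.cong y) (a ⁻¹ ∙ g)))
          (Δ-* y y∈Δ (ι a ⟦ g ⟧)))
        (≡.cong₂ ℤ._-_ (∑-ιʳ (y ⟦_⟧) (Func.cong y) g) (Δ-* y y∈Δ (ι ε ⟦ g ⟧))))

  sum-⟦⟧ : ∀ {m} (w : Vector ℤA m) g → sum w ⟦ g ⟧ ≡ sumℤ (λ i → w i ⟦ g ⟧)
  sum-⟦⟧ {zero}  w g = refl
  sum-⟦⟧ {suc m} w g = cong (λ k → w zero ⟦ g ⟧ ℤ.+ k) (sum-⟦⟧ (w ∘ suc) g)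

  module Span {m} (v : Vector ℤA m) where

    -- Speaks of bare functions rather than of `ℤA`: no congruence proofs are carried along, and the
    -- quotient below stays at level c.
    Span : (Carrier → ℤ) → Set c
    Span x = ∃ λ (n : Vector ℤ m) → ∀ g → x g ≡ sumℤ (λ i → n i ℤ.* v i ⟦ g ⟧)

    span-cong : ∀ {x y} → (∀ g → y g ≡ x g) → Span x → Span y
    span-cong y≡x (n , eq) = n , λ g → ≡.trans (y≡x g) (eq g)

    span-0 : Span (λ _ → 0ℤ)
    span-0 = (λ _ → 0ℤ) , λ g → ≡.sym (sum-zero {m} (λ _ → 0ℤ) λ _ → refl)

    span-+ : ∀ {x y} → Span x → Span y → Span (λ g → x g ℤ.+ y g)
    span-+ (n , eq) (n′ , eq′) = (λ i → n i ℤ.+ n′ i) , λ g → ≡.trans (≡.cong₂ ℤ._+_ (eq g) (eq′ g))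
      (≡.trans (≡.sym (∑-distrib-+ (λ i → n i ℤ.* v i ⟦ g ⟧) (λ i → n′ i ℤ.* v i ⟦ g ⟧)))
               (sum-cong-≗ λ i → ≡.sym (ℤ.*-distribʳ-+ (v i ⟦ g ⟧) (n i) (n′ i))))

    span-* : ∀ k {x} → Span x → Span (λ g → k ℤ.* x g)
    span-* k (n , eq) = (λ i → k ℤ.* n i) , λ g → ≡.trans (cong (k ℤ.*_) (eq g))
      (≡.trans (*-distribˡ-sum k (λ i → n i ℤ.* v i ⟦ g ⟧))
               (sum-cong-≗ λ i → ≡.sym (ℤ.*-assoc k (n i) (v i ⟦ g ⟧))))

    span-neg : ∀ {x} → Span x → Span (λ g → ℤ.- x g)
    span-neg {x} s = span-cong (λ g → ≡.sym (ℤ.-1*i≡-i (x g))) (span-* (ℤ.- 1ℤ) s)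

    span-v : ∀ i → Span (v i ⟦_⟧)
    span-v i = δ , λ g → ≡.sym (≡.trans
      (sum-single (λ k → δ k ℤ.* v k ⟦ g ⟧) i λ k k≢i →
        cong (λ b → (if b then 1ℤ else 0ℤ) ℤ.* v k ⟦ g ⟧) (dec-false (k Fin.≟ i) k≢i))
      (≡.trans (cong (λ b → (if b then 1ℤ else 0ℤ) ℤ.* v i ⟦ g ⟧) (dec-true (i Fin.≟ i) refl))
               (ℤ.*-identityˡ (v i ⟦ g ⟧))))
      where
      δ : Vector ℤ m
      δ k = if does (k Fin.≟ i) then 1ℤ else 0ℤ

    span-sum : ∀ {k} (x : Fin k → Carrier → ℤ) → (∀ i → Span (x i)) → Span (λ g → sumℤ (λ i → x i g))
    span-sum {zero}  x s = span-0
    span-sum {suc k} x s = span-+ (s zero) (span-sum (x ∘ suc) (s ∘ suc))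

    span-∑ : ∀ (x : Carrier → Carrier → ℤ) → (∀ a → Span (x a)) → Span (λ g → ∑ (λ a → x a g))
    span-∑ x s = span-sum (x ∘ element) (s ∘ element)

    infix 4 _~_
    _~_ : (x y : Carrier → ℤ) → Set c
    x ~ y = Span (λ g → x g ℤ.- y g)

    ≗⇒~ : ∀ {x y} → (∀ g → x g ≡ y g) → x ~ y
    ≗⇒~ eq = span-cong (λ g → ℤ.i≡j⇒i-j≡0 (eq g)) span-0

    -- The integer functions on A modulo the span of v, as a setoid; this is the group to which
    -- `generates` is applied.
    quotient : AbelianGroup c c
    quotient = record
      { Carrier = Carrier → ℤ
      ; _≈_     = _~_
      ; _∙_     = λ x y g → x g ℤ.+ y g
      ; ε       = λ _ → 0ℤ
      ; _⁻¹     = λ x g → ℤ.- x g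
      ; isAbelianGroup = record
        { isGroup = record
          { isMonoid = record
            { isSemigroup = record
              { isMagma = record
                { isEquivalence = record
                  { refl  = λ {x} → ≗⇒~ {x} λ _ → refl
                  ; sym   = λ {x} {y} s → span-cong (λ g → ring-sym (x g) (y g)) (span-neg s)
                  ; trans = λ {x} {y} {z} s t → span-cong (λ g → ring-trans (x g) (y g) (z g)) (span-+ s t)
                  }
                ; ∙-cong = λ {x} {y} {u} {w} s t →
                    span-cong (λ g → ring-+ (x g) (y g) (u g) (w g)) (span-+ s t)
                }
              ; assoc = λ x y z → ≗⇒~ λ g → ℤ.+-assoc (x g) (y g) (z g)
              }
            ; identity = (λ x → ≗⇒~ λ g → ℤ.+-identityˡ (x g)) , (λ x → ≗⇒~ λ g → ℤ.+-identityʳ (x g))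
            }
          ; inverse = (λ x → ≗⇒~ λ g → ℤ.+-inverseˡ (x g)) , (λ x → ≗⇒~ λ g → ℤ.+-inverseʳ (x g))
          ; ⁻¹-cong = λ {x} {y} s → span-cong (λ g → ring-neg (x g) (y g)) (span-neg s)
          }
        ; comm = λ x y → ≗⇒~ λ g → ℤ.+-comm (x g) (y g)
        }
      }
      where
      ring-sym : ∀ x y → y ℤ.- x ≡ ℤ.- (x ℤ.- y)
      ring-sym = solve-∀
      ring-trans : ∀ x y z → x ℤ.- z ≡ (x ℤ.- y) ℤ.+ (y ℤ.- z)
      ring-trans = solve-∀
      ring-+ : ∀ x y u w → (x ℤ.+ u) ℤ.- (y ℤ.+ w) ≡ (x ℤ.- y) ℤ.+ (u ℤ.- w)
      ring-+ = solve-∀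
      ring-neg : ∀ x y → ℤ.- x ℤ.- ℤ.- y ≡ ℤ.- (x ℤ.- y)
      ring-neg = solve-∀

  module FromPresentation (H : Subgroup) (full : Subgroup.Full H) (P : Presentation H) where
    open Subgroup H
    open Presentation P

    vector : J → ℤA
    vector j = (ι (el (left j)) - 1#) * (ι (nonunit (right j)) - 1#)

    basis : Vector ℤA count
    basis i = vector (Inverse.to relations i)

    vector-⟦⟧ : ∀ j g → vector j ⟦ g ⟧ ≡ q (el (left j)) (nonunit (right j)) g
    vector-⟦⟧ j = product-form (el (left j)) (nonunit (right j))

    open Span basis

    -- Modulo the span, F(y) = y - 1 satisfies the relations of the presentation, hence F(yy′) =
    -- F(y) + F(y′) throughout; the difference of the two sides is (y - 1)(y′ - 1).
    q∈Span : ∀ a b → Span (q a b)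
    q∈Span a b = let (y , y≈a) = full a ; (y′ , y′≈b) = full b in
      span-cong (λ g → ≡.trans
          (≡.cong₂ ℤ._-_
            (≡.cong₂ ℤ._-_
              (ι-congˡ (A.trans (A.∙-cong (A.sym y≈a) (A.sym y′≈b)) (A.sym (el-mul y y′))) g)
              (ι-congˡ (A.sym y≈a) g))
            (cong (ℤ._- ι ε ⟦ g ⟧) (ι-congˡ (A.sym y′≈b) g)))
          (ring (ι (el (mul y y′)) ⟦ g ⟧) (ι (el y) ⟦ g ⟧) (ι (el y′) ⟦ g ⟧) (ι ε ⟦ g ⟧)))
        (generates quotient F (≗⇒~ λ g → ℤ.+-inverseʳ (ι ε ⟦ g ⟧)) F-product y y′)
      where
      F : Maybe X → Carrier → ℤ
      F y g = ι (el y) ⟦ g ⟧ ℤ.- ι ε ⟦ g ⟧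
      ring : ∀ c a b e → c ℤ.- a ℤ.- (b ℤ.- e) ≡ (c ℤ.- e) ℤ.- ((a ℤ.- e) ℤ.+ (b ℤ.- e))
      ring = solve-∀
      F-product : ∀ j → F (product j) ~ λ g → F (left j) g ℤ.+ F (just (right j)) g
      F-product j = span-cong (λ g → ≡.sym (begin
        basis (Inverse.from relations j) ⟦ g ⟧
          ≡⟨ cong (λ j → vector j ⟦ g ⟧) (Inverse.strictlyInverseˡ relations j) ⟩
        vector j ⟦ g ⟧
          ≡⟨ vector-⟦⟧ j g ⟩
        q (el (left j)) (nonunit (right j)) g
          ≡⟨ cong (λ w → w ℤ.- ι (el (left j)) ⟦ g ⟧ ℤ.- (ι (nonunit (right j)) ⟦ g ⟧ ℤ.- ι ε ⟦ g ⟧))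
                  (ι-congˡ (A.sym (el-product j)) g) ⟩
        ι (el (product j)) ⟦ g ⟧ ℤ.- ι (el (left j)) ⟦ g ⟧ ℤ.- (ι (nonunit (right j)) ⟦ g ⟧ ℤ.- ι ε ⟦ g ⟧)
          ≡⟨ ring (ι (el (product j)) ⟦ g ⟧) (ι (el (left j)) ⟦ g ⟧) (ι (nonunit (right j)) ⟦ g ⟧) (ι ε ⟦ g ⟧) ⟩
        F (product j) g ℤ.- (F (left j) g ℤ.+ F (just (right j)) g) ∎))
        (span-v (Inverse.from relations j))
        where open ≡.≡-Reasoning

    Δ²⊆Span : ∀ {x} → x ∈ Δ² → Span (x ⟦_⟧)
    Δ²⊆Span (generator (x , y , x∈Δ , y∈Δ , z≈xy)) =
      span-cong (λ g → ≡.trans (z≈xy g) (Δ-product x y x∈Δ y∈Δ g))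
        (span-∑ (λ a g → x ⟦ a ⟧ ℤ.* ∑ (λ b → y ⟦ b ⟧ ℤ.* q a b g)) λ a → span-* (x ⟦ a ⟧)
          (span-∑ (λ b g → y ⟦ b ⟧ ℤ.* q a b g) λ b → span-* (y ⟦ b ⟧) (q∈Span a b)))
    Δ²⊆Span zero             = span-0
    Δ²⊆Span (plus x y)       = span-+ (Δ²⊆Span x) (Δ²⊆Span y)
    Δ²⊆Span (negate x)       = span-neg (Δ²⊆Span x)
    Δ²⊆Span (respects x≈y x) = span-cong (λ g → ≡.sym (x≈y g)) (Δ²⊆Span x)

    coordinate : Carrier → Maybe X
    coordinate a = proj₁ (full a)

    coordinate-cong : ∀ {a b} → a ≈ᴬ b → coordinate a ≡ coordinate b
    coordinate-cong {a} {b} a≈b = el-injective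
      (A.trans (proj₂ (full a)) (A.trans a≈b (A.sym (proj₂ (full b)))))

    coordinate-el : ∀ y → coordinate (el y) ≡ y
    coordinate-el y = el-injective (proj₂ (full (el y)))

    -- Applied to a functional f for independence, and to f = `vector j` itself for the length.
    ∑-vector : ∀ f → Congruent f → ∀ j → ∑ (λ g → f g ℤ.* vector j ⟦ g ⟧) ≡
               f (el (product j)) ℤ.- f (el (left j)) ℤ.- (f (nonunit (right j)) ℤ.- f ε)
    ∑-vector f f-cong j = ≡.trans
      (∑-cong λ g → cong (f g ℤ.*_) (vector-⟦⟧ j g))
      (≡.trans (∑-q f f-cong (el (left j)) (nonunit (right j)))
        (cong (λ w → w ℤ.- f (el (left j)) ℤ.- (f (nonunit (right j)) ℤ.- f ε)) (f-cong (A.sym (el-product j)))))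

    ∑-defect : ∀ d → d nothing ≡ 0ℤ → ∀ j → ∑ (λ g → d (coordinate g) ℤ.* vector j ⟦ g ⟧) ≡ defect d j
    ∑-defect d d-unit j = ≡.trans (∑-vector (d ∘ coordinate) (cong d ∘ coordinate-cong) j)
      (≡.cong₂ ℤ._-_
        (≡.cong₂ ℤ._-_ (cong d (coordinate-el (product j))) (cong d (coordinate-el (left j))))
        (≡.trans (≡.cong₂ ℤ._-_ (cong d (coordinate-el (just (right j))))
                                (≡.trans (cong d (coordinate-el nothing)) d-unit))
                 (ℤ.+-identityʳ _)))

    -- Z consists of the relations with coefficient 0. Pairing the dependency with a functional d
    -- gives a vanishing sum of coefficients times defects; if only the term of j can survive, then
    -- that term is 0, and a nonzero defect forces the coefficient to be 0.
    independent : ∀ (n : Vector ℤ count) → sum (λ i → n i • basis i) ≈ 0# → ∀ i → n i ≡ 0ℤ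
    independent n eq i = ≡.subst (λ i → n i ≡ 0ℤ) (Inverse.strictlyInverseʳ relations i)
      (eliminates (λ j → n (Inverse.from relations j) ≡ 0ℤ) close (Inverse.to relations i))
      where
      to   = Inverse.to relations
      from = Inverse.from relations

      pairing : ∀ d → d nothing ≡ 0ℤ → sumℤ (λ i → n i ℤ.* defect d (to i)) ≡ 0ℤ
      pairing d d-unit = begin
        sumℤ (λ i → n i ℤ.* defect d (to i))
          ≡⟨ sum-cong-≗ (λ i → cong (n i ℤ.*_) (≡.sym (∑-defect d d-unit (to i)))) ⟩
        sumℤ (λ i → n i ℤ.* ∑ (λ g → f g ℤ.* basis i ⟦ g ⟧))
          ≡⟨ sum-cong-≗ (λ i → *-distribˡ-∑ (n i) (λ g → f g ℤ.* basis i ⟦ g ⟧)) ⟩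
        sumℤ (λ i → ∑ (λ g → n i ℤ.* (f g ℤ.* basis i ⟦ g ⟧)))
          ≡⟨ ∑-comm (λ i k → n i ℤ.* (f (element k) ℤ.* basis i ⟦ element k ⟧)) ⟩
        ∑ (λ g → sumℤ (λ i → n i ℤ.* (f g ℤ.* basis i ⟦ g ⟧)))
          ≡⟨ ∑-cong (λ g → sum-cong-≗ λ i → ring (n i) (f g) (basis i ⟦ g ⟧)) ⟩
        ∑ (λ g → sumℤ (λ i → f g ℤ.* (n i ℤ.* basis i ⟦ g ⟧)))
          ≡⟨ ∑-cong (λ g → ≡.sym (*-distribˡ-sum (f g) (λ i → n i ℤ.* basis i ⟦ g ⟧))) ⟩
        ∑ (λ g → f g ℤ.* sumℤ (λ i → n i ℤ.* basis i ⟦ g ⟧))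
          ≡⟨ sum-zero (λ k → f (element k) ℤ.* sumℤ (λ i → n i ℤ.* basis i ⟦ element k ⟧))
               (λ k → ≡.trans (cong (f (element k) ℤ.*_)
               (≡.trans (≡.sym (sum-⟦⟧ (λ i → n i • basis i) (element k))) (eq (element k))))
               (ℤ.*-zeroʳ (f (element k)))) ⟩
        0ℤ ∎
        where
        open ≡.≡-Reasoning
        f : Carrier → ℤ
        f g = d (coordinate g)
        ring : ∀ n f b → n ℤ.* (f ℤ.* b) ≡ f ℤ.* (n ℤ.* b)
        ring = solve-∀

      close : ∀ d j → d nothing ≡ 0ℤ → defect d j ≢ 0ℤ →
              (∀ k → k ≢ j → n (from k) ≡ 0ℤ ⊎ defect d k ≡ 0ℤ) → n (from j) ≡ 0ℤ
      close d j d-unit nonzero others =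
        [ id , (λ defect≡0 → contradiction defect≡0 nonzero) ]′ (ℤ.i*j≡0⇒i≡0∨j≡0 (n (from j)) (begin
          n (from j) ℤ.* defect d j
            ≡⟨ cong (λ k → n (from j) ℤ.* defect d k) (Inverse.strictlyInverseˡ relations j) ⟨
          n (from j) ℤ.* defect d (to (from j))
            ≡⟨ sum-single (λ i → n i ℤ.* defect d (to i)) (from j) vanish ⟨
          sumℤ (λ i → n i ℤ.* defect d (to i))
            ≡⟨ pairing d d-unit ⟩
          0ℤ ∎))
        where
        open ≡.≡-Reasoning
        vanish : ∀ i → i ≢ from j → n i ℤ.* defect d (to i) ≡ 0ℤ
        vanish i i≢ with others (to i) (λ eq →
           i≢ (≡.trans (≡.sym (Inverse.strictlyInverseʳ relations i)) (cong from eq)))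
        ... | inj₁ n≡0 = cong (ℤ._* defect d (to i))
                              (≡.trans (cong n (≡.sym (Inverse.strictlyInverseʳ relations i))) n≡0)
        ... | inj₂ eq = ≡.trans (cong (n i ℤ.*_) eq) (ℤ.*-zeroʳ (n i))

    isLatticeBasis : IsLatticeBasis Δ² basis
    isLatticeBasis = record
      { member = λ i → let j = Inverse.to relations i in
          generator (ι (el (left j)) - 1# , ι (nonunit (right j)) - 1# ,
                     ι-1#∈Δ (el (left j)) , ι-1#∈Δ (nonunit (right j)) , λ _ → refl)
      ; independent = independent
      ; spanning = λ x∈Δ² → let (n , eq) = Δ²⊆Span x∈Δ² in
          n , λ g → ≡.trans (eq g) (≡.sym (sum-⟦⟧ (λ i → n i • basis i) g))
      }

    productBasis : HasLatticeBasisOf Δ² ProductForm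
    productBasis = count , basis , isLatticeBasis , λ i →
      let j = Inverse.to relations i in el (left j) , nonunit (right j) , λ _ → refl

    -- The sum of squares is the pairing of v with itself, v(ab) - v(a) - v(b) + v(1). With 1, a, b,
    -- ab distinct these values are 1, -1, -1, 1, and the total is 4.
    lengthTwo : Quadrilateral → ∀ j → HasLength 2 (vector j)
    lengthTwo quad j = ≡.trans (∑-vector (v ⟦_⟧) (Func.cong v) j) (≡.cong₂ ℤ._-_
      (≡.cong₂ ℤ._-_
        (value (product j) 1ℤ 0ℤ 0ℤ 0ℤ (ι-true A.refl) (ι-≢ l≢p) (ι-≢ r≢p) (ι-≢ e≢p))
        (value (left j) 0ℤ 1ℤ 0ℤ 0ℤ (ι-≢ (l≢p ∘ ≡.sym)) (ι-true A.refl) (ι-≢ (l≢r ∘ ≡.sym)) (ι-≢ (l≢e ∘ ≡.sym))))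
      (≡.cong₂ ℤ._-_
        (value (just (right j)) 0ℤ 0ℤ 1ℤ 0ℤ (ι-≢ (r≢p ∘ ≡.sym)) (ι-≢ l≢r) (ι-true A.refl)
          (ι-≢ {nothing} {just (right j)} λ ()))
        (value nothing 0ℤ 0ℤ 0ℤ 1ℤ (ι-≢ (e≢p ∘ ≡.sym)) (ι-≢ l≢e)
          (ι-≢ {just (right j)} {nothing} λ ()) (ι-true A.refl))))
      where
      v = vector j
      l≢e = proj₁ (quad j)
      l≢r = proj₁ (proj₂ (quad j))
      e≢p : nothing ≢ product j
      e≢p = proj₂ (proj₂ (quad j)) ∘ ≡.sym
      l≢p : left j ≢ product j
      l≢p eq = case el-injective {just (right j)} {nothing} (identityʳ-unique _ _
        (A.trans (A.sym (el-product j)) (A.reflexive (cong el (≡.sym eq))))) of λ ()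
      r≢p : just (right j) ≢ product j
      r≢p eq = l≢e (el-injective {left j} {nothing} (identityˡ-unique _ _
        (A.trans (A.sym (el-product j)) (A.reflexive (cong el (≡.sym eq))))))
      ι-≢ : ∀ {y y′} → y ≢ y′ → ι (el y) ⟦ el y′ ⟧ ≡ 0ℤ
      ι-≢ y≢y′ = ι-false (y≢y′ ∘ el-injective)
      value : ∀ y p l r e → ι (el (product j)) ⟦ el y ⟧ ≡ p → ι (el (left j)) ⟦ el y ⟧ ≡ l →
              ι (nonunit (right j)) ⟦ el y ⟧ ≡ r → ι ε ⟦ el y ⟧ ≡ e →
              v ⟦ el y ⟧ ≡ p ℤ.- l ℤ.- (r ℤ.- e)
      value y p l r e p≡ l≡ r≡ e≡ = ≡.trans (vector-⟦⟧ j (el y))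
        (≡.cong₂ ℤ._-_ (≡.cong₂ ℤ._-_ (≡.trans (ι-congˡ (A.sym (el-product j)) (el y)) p≡) l≡)
                       (≡.cong₂ ℤ._-_ r≡ e≡))

    lengthTwoBasis : Quadrilateral → HasLatticeBasisOf Δ² (HasLength 2)
    lengthTwoBasis quad = count , basis , isLatticeBasis , λ i → lengthTwo quad (Inverse.to relations i)

-- Climbing to A, and the choice of the last extension

module Towers {c ℓ} (FA : FiniteAbelianGroup c ℓ) where
  open FiniteAbelianGroup FA using (enumeration; element; index; order) renaming (abelianGroup to A)
  open AbelianGroup A using (Carrier; _∙_; ε; _≈_)
  private module A = AbelianGroup A
  open Algebra.Properties.AbelianGroup A using (identityʳ-unique; ∙-cancelˡ)
  open Algebra.Properties.Monoid.Mult A.monoid using (×-homo-+; ×-congˡ) renaming (_×_ to _⋆_)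
  open Subgroups A
  open Presentations A c c
  open GroupRing FA using (HasLatticeBasisOf; Δ²; ProductForm; HasLength)
  open Lattice FA using (index-injective; module FromPresentation)
  open Cyclic A c c

  _≈?_ : ∀ a b → Dec (a ≈ b)
  a ≈? b = map′ index-injective (Inverse.from-cong enumeration) (index a Fin.≟ index b)

  module _ (H : Subgroup) where
    open Subgroup H

    private
      encoding : Fin (suc size) ↔ Maybe X
      encoding = Fin-suc↔Maybe elements
      module E = Inverse encoding

    member? : ∀ a → Dec (∃ λ y → el y ≈ a)
    member? a = map′
      (λ (i , eq) → E.to i , eq)
      (λ (y , eq) → E.from y , A.trans (A.reflexive (cong el (E.strictlyInverseˡ y))) eq)
      (Fin.any? λ i → el (E.to i) ≈? a)

    full-or-proper : Full ⊎ ∃ λ a → ¬ ∃ λ y → el y ≈ a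
    full-or-proper with Fin.all? (λ i → member? (element i))
    ... | yes all = inj₁ λ a → let (y , eq) = all (index a) in
      y , A.trans eq (Inverse.strictlyInverseˡ enumeration a)
    ... | no ¬all = let (i , ∉) = Fin.¬∀⟶∃¬ order _ (λ i → member? (element i)) ¬all in
      inj₂ (element i , ∉)

    -- Strict because `size` leaves out the unit.
    size<order : size ℕ.< order
    size<order = Fin.injective⇒≤ {f = λ i → index (el (E.to i))} λ {i} {j} eq →
      ≡.trans (≡.sym (E.strictlyInverseʳ i))
        (≡.trans (cong E.from (el-injective (index-injective eq))) (E.strictlyInverseʳ j))

    full⇒order≤ : Full → order ℕ.≤ suc size
    full⇒order≤ full = Fin.injective⇒≤ {f = λ i → E.from (proj₁ (full (element i)))} λ {i} {j} eq →
      let yᵢ , eqᵢ = full (element i)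
          yⱼ , eqⱼ = full (element j)
          y≡ : yᵢ ≡ yⱼ
          y≡ = ≡.trans (≡.sym (E.strictlyInverseˡ yᵢ)) (≡.trans (cong E.to eq) (E.strictlyInverseˡ yⱼ))
      in ≡.trans (≡.sym (Inverse.strictlyInverseʳ enumeration i))
           (≡.trans (Inverse.from-cong enumeration
              (A.trans (A.sym eqᵢ) (A.trans (A.reflexive (cong el y≡)) eqⱼ)))
            (Inverse.strictlyInverseʳ enumeration j))

  torsion : ∀ g → ∃ λ n → suc n ⋆ g ≈ ε
  torsion g with Fin.pigeonhole (ℕ.n<1+n order) (λ i → index (toℕ i ⋆ g))
  ... | i , j , i<j , eq = toℕ j ℕ.∸ suc (toℕ i) , identityʳ-unique (toℕ i ⋆ g) _
    (A.trans (A.sym (×-homo-+ g (toℕ i) _))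
    (A.trans (×-congˡ (≡.trans (ℕ.+-suc (toℕ i) _) (ℕ.m+[n∸m]≡n i<j))) (A.sym (index-injective eq))))

  -- The degree is the least positive exponent m with gᵐ in H. It exists because g has finite order,
  -- and it is at least 2 because g lies outside H.
  extend : ∀ H (let open Subgroup H) g → ¬ (∃ λ y → el y ≈ g) → Extension H
  extend H g g∉H with torsion g
  ... | n , gⁿ⁺¹≈ε with Fin.¬∀⟶∃¬-smallest (suc n) _ (λ i → ¬? (member? H (suc (toℕ i) ⋆ g)))
          (λ all → all (fromℕ n) (nothing , A.trans (A.sym gⁿ⁺¹≈ε)
            (×-congˡ (cong suc (≡.sym (Fin.toℕ-fromℕ n))))))
  ... | i , ¬¬∈ , ∉ with decidable-stable (member? H (suc (toℕ i) ⋆ g)) ¬¬∈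
  extend H g g∉H | n , _ | zero , _ , _ | z , eq = contradiction (z , A.trans eq (A.identityʳ g)) g∉H
  extend H g g∉H | n , _ | suc i , _ , ∉ | z , eq = record
    { g = g ; p = toℕ i ; z = z ; el-z = eq
    ; minimal = λ j y y≈ → ∉ j (y , A.trans y≈ (×-congˡ (cong suc (≡.sym (Fin.toℕ-inject j)))))
    }

  -- Carries a presentation of H only. The parameters `t` and `u` of the last extension stay open,
  -- since the two parts of the theorem choose them differently.
  record LastStep : Set (Level.suc Level.zero ⊔ Level.suc c ⊔ ℓ) where
    field
      H            : Subgroup
      presentation : Presentation H
      extension    : Extension H
      full         : Subgroup.Full (Extended.extended H extension)

  -- Terminates on k, a bound for the extensions still to come: `size` grows each time and stays
  -- below `order`.
  climb : ∀ k (H : Subgroup) → Presentation H → order ℕ.≤ Subgroup.size H ℕ.+ k →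
          Subgroup.Full H ⊎ LastStep
  climb zero H P order≤ = contradiction
    (ℕ.≤-trans (size<order H) (≡.subst (order ℕ.≤_) (ℕ.+-identityʳ _) order≤)) (ℕ.<-irrefl refl)
  climb (suc k) H P order≤ with full-or-proper H
  ... | inj₁ full      = inj₁ full
  -- If the extension is all of A, the present step is the last one; otherwise the last step found
  -- further up is passed on.
  ... | inj₂ (g , g∉H) = inj₂ ([ (λ full → record { presentation = P ; full = full }) , id ]′
    (climb k extended extended-presentation (begin
      order                                             ≤⟨ order≤ ⟩
      size ℕ.+ suc k                                    ≡⟨ ℕ.+-suc size k ⟩
      suc (size ℕ.+ k)                                  ≤⟨ ℕ.s≤s (ℕ.+-monoˡ-≤ k (ℕ.m≤m+n size _)) ⟩
      suc (size ℕ.+ (size ℕ.+ p ℕ.* suc size) ℕ.+ k)    ≡⟨ cong (ℕ._+ k) (ℕ.+-suc size _) ⟨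
      size ℕ.+ suc p ℕ.* suc size ℕ.+ k                 ∎)))
    where
    open ℕ.≤-Reasoning
    open Subgroup H using (size)
    E = extend H g g∉H
    open Extension E using (p)
    open Extended H E using (extended)
    -- Below the last extension the plainest choice suffices: for length 2, the shift by g in the
    -- last one removes the coincidences in all older relations.
    open ExtendedPresentation H E P zero (λ _ → nothing) using (extended-presentation)

  trivial-or-step : Subgroup.Full trivial ⊎ LastStep
  trivial-or-step = climb order trivial trivial-presentation ℕ.≤-refl

  product-basis : HasLatticeBasisOf Δ² ProductForm
  product-basis with trivial-or-step
  ... | inj₁ full = FromPresentation.productBasis trivial full trivial-presentation
  ... | inj₂ last = FromPresentation.productBasis extended full extended-presentation
    where
    open LastStep last
    open Extended H extension using (extended)
    open ExtendedPresentation H extension presentation zero (λ _ → nothing) using (extended-presentation)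

  -- C₂ × C₂ enters the argument through its exponent and through having at least 4 elements; the
  -- exponent excludes the cyclic group of order 4.
  Exponent2 : Set (c ⊔ ℓ)
  Exponent2 = ∀ a → a ∙ a ≈ ε

  Klein⇒exponent2 : A ≅ C₂×C₂ → Exponent2
  Klein⇒exponent2 (φ , iso) a = injective (K.trans (∙-homo a a)
    (K.trans (ℙ.p+p≡0ℙ (proj₁ (φ a)) , ℙ.p+p≡0ℙ (proj₂ (φ a))) (K.sym ε-homo)))
    where
    module K = AbelianGroup C₂×C₂
    open GroupMorphisms.IsGroupIsomorphism iso using (injective; ∙-homo; ε-homo)

  Klein⇒4≤order : A ≅ C₂×C₂ → 4 ℕ.≤ order
  Klein⇒4≤order (φ , iso) = Fin.injective⇒≤ {f = λ i → index (preimage i)} λ {i} {j} eq →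
    let eq₁ , eq₂ = K.trans (K.sym (φ-preimage i))
                      (K.trans (⟦⟧-cong (index-injective eq)) (φ-preimage j))
    in ≡.trans (≡.sym (decode-encode i)) (≡.trans (≡.cong₂ decode eq₁ eq₂) (decode-encode j))
    where
    module K = AbelianGroup C₂×C₂
    open GroupMorphisms.IsGroupIsomorphism iso using (surjective; ⟦⟧-cong)
    encode : Fin 4 → K.Carrier
    encode 0F = 0ℙ , 0ℙ
    encode 1F = 0ℙ , 1ℙ
    encode 2F = 1ℙ , 0ℙ
    encode 3F = 1ℙ , 1ℙ
    decode : Parity → Parity → Fin 4
    decode 0ℙ 0ℙ = 0F
    decode 0ℙ 1ℙ = 1F
    decode 1ℙ 0ℙ = 2F
    decode 1ℙ 1ℙ = 3F
    decode-encode : ∀ i → decode (proj₁ (encode i)) (proj₂ (encode i)) ≡ i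
    decode-encode 0F = refl
    decode-encode 1F = refl
    decode-encode 2F = refl
    decode-encode 3F = refl
    preimage : Fin 4 → Carrier
    preimage i = proj₁ (surjective (encode i))
    φ-preimage : ∀ i → φ (preimage i) K.≈ encode i
    φ-preimage i = proj₂ (surjective (encode i)) A.refl

  module _ (H : Subgroup) (P : Presentation H) (E : Extension H)
           (full : Subgroup.Full (Extended.extended H E)) where
    open Subgroup H
    open Extension E
    open Extended H E using (extended)

    length-two-basis-from : (u : Fin (suc p) → Maybe X) → u zero ≢ nothing →
                            mul z (u (fromℕ p)) ≢ nothing → HasLatticeBasisOf Δ² (HasLength 2)
    length-two-basis-from u u₀≢ zuₚ≢ =
      FromPresentation.lengthTwoBasis extended full extended-presentation
        (extended-quadrilateral refl u₀≢ zuₚ≢)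
      where open ExtendedPresentation H E P (suc zero) u

  length-two-basis : ∀ H → Presentation H → ∀ E → Subgroup.Full (Extended.extended H E) →
                     4 ℕ.≤ order → order > 4 ⊎ Exponent2 → HasLatticeBasisOf Δ² (HasLength 2)
  length-two-basis H P E full 4≤order order>4⊎exponent2 = go size refl
    where
    open Subgroup H using (X; size; elements; el; nonunit; mul; el-injective; el-mul)

    mul-nothingˡ : ∀ x → mul nothing (just x) ≢ nothing
    mul-nothingˡ x eq = case el-injective {just x} {nothing} (A.trans (A.sym (A.identityˡ _))
      (A.trans (A.sym (el-mul nothing (just x))) (A.reflexive (cong el eq)))) of λ ()

    mul-nothingʳ : ∀ x → mul (just x) nothing ≢ nothing
    mul-nothingʳ x eq = case el-injective {just x} {nothing} (A.trans (A.sym (A.identityʳ _))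
      (A.trans (A.sym (el-mul (just x) nothing)) (A.reflexive (cong el eq)))) of λ ()

    square : Exponent2 → ∀ g → ε ≈ 2 ⋆ g
    square exponent2 g = A.sym (A.trans (A.∙-congˡ (A.identityʳ g)) (exponent2 g))

    order≤ : ∀ E → Subgroup.Full (Extended.extended H E) → ∀ {n} → size ≡ n →
             order ℕ.≤ suc (n ℕ.+ suc (Extension.p E) ℕ.* suc n)
    order≤ E full refl = full⇒order≤ (Extended.extended H E) full

    order≤4⇒exponent2 : order ℕ.≤ 4 → Exponent2
    order≤4⇒exponent2 order≤4 = [ (λ order>4 → contradiction order≤4 (ℕ.<⇒≱ order>4)) , id ]′ order>4⊎exponent2

    cyclic : ¬ X → size ≡ 0 → ∀ E → Subgroup.Full (Extended.extended H E) →
             HasLatticeBasisOf Δ² (HasLength 2)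
    cyclic only-unit _ record { z = just x } _ = contradiction x only-unit
    cyclic only-unit _
      record { g = g ; p = suc (suc (suc k)) ; z = nothing ; el-z = el-z ; minimal = minimal } full =
      FromPresentation.lengthTwoBasis _ full cyclic-presentation cyclic-quadrilateral
      where open CyclicPresentation H only-unit g k el-z minimal
    cyclic _ size≡0 E@record { p = 0 } full =
      contradiction (ℕ.≤-trans 4≤order (order≤ E full size≡0)) (ℕ.<⇒≱ (ℕ.s≤s (ℕ.s≤s (ℕ.s≤s ℕ.z≤n))))
    -- For degrees 3 and 4 the order is at most 4, so the hypothesis leaves exponent 2; then g² = 1,
    -- below the degree.
    cyclic _ size≡0 E@record { g = g ; p = 1 ; minimal = minimal } full =
      contradiction (square (order≤4⇒exponent2 (ℕ.≤-trans (order≤ E full size≡0) (ℕ.n≤1+n 3))) g)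
        (minimal (suc zero) nothing)
    cyclic _ size≡0 E@record { g = g ; p = 2 ; minimal = minimal } full =
      contradiction (square (order≤4⇒exponent2 (order≤ E full size≡0)) g) (minimal (suc zero) nothing)

    noncyclic : ∀ {n} → size ≡ suc n → (x : Fin (suc n) → X) → (∀ {i j} → x i ≡ x j → i ≡ j) →
                ∀ E → Subgroup.Full (Extended.extended H E) → HasLatticeBasisOf Δ² (HasLength 2)
    -- With z = 1 any nontrivial constant u works, as z uₚ = uₚ.
    noncyclic _ x _ E@record { z = nothing } full =
      length-two-basis-from H P E full (λ _ → just (x zero)) (λ ()) (mul-nothingˡ (x zero))
    -- From degree 3 on, u₀ and uₚ are separate entries: u₀ is nontrivial, and uₚ = 1 leaves z uₚ =
    -- z ≠ 1.
    noncyclic _ x _ E@record { p = suc p ; z = just w } full =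
      length-two-basis-from H P E full
        (λ { zero → just (x zero) ; (suc _) → nothing }) (λ ()) (mul-nothingʳ w)
    -- Here H has order 2 and the degree is 2, so u₀ = uₚ would have to avoid both elements of H.
    -- But g² = w ≠ 1 contradicts exponent 2, which holds as the order is at most 4.
    noncyclic {zero} size≡1 x _ E@record { g = g ; p = zero ; z = just w ; el-z = el-z } full =
      case el-injective {just w} {nothing} (A.trans el-z
        (A.sym (square (order≤4⇒exponent2 (order≤ E full size≡1)) g))) of λ ()
    -- In degree 2 the single u₀ = uₚ must differ from 1 and from z⁻¹; of two distinct nontrivial
    -- elements at most one is z⁻¹.
    noncyclic {suc n} _ x x-injective E@record { p = zero ; z = z@(just w) } full
      with mul z (just (x zero)) in eq₀ | mul z (just (x (suc zero))) in eq₁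
    ... | just _ | _ = length-two-basis-from H P E full (λ _ → just (x zero)) (λ ())
                         λ eq → case ≡.trans (≡.sym eq₀) eq of λ ()
    ... | nothing | just _ = length-two-basis-from H P E full (λ _ → just (x (suc zero))) (λ ())
                               λ eq → case ≡.trans (≡.sym eq₁) eq of λ ()
    ... | nothing | nothing = case x-injective (just-injective (el-injective {just _} {just _}
            (∙-cancelˡ (nonunit w) _ _ (A.trans (A.sym (el-mul z _))
              (A.trans (A.reflexive (cong el (≡.trans eq₀ (≡.sym eq₁)))) (el-mul z _)))))) of λ ()

    go : ∀ n → size ≡ n → HasLatticeBasisOf Δ² (HasLength 2)
    go zero    eq = cyclic (λ x → Fin.¬Fin0 (≡.subst Fin eq (Inverse.from elements x))) eq E full
    go (suc n) eq = noncyclic eq (λ i → Inverse.to elements (≡.subst Fin (≡.sym eq) i))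
      (λ {i} {j} xᵢ≡xⱼ → subst-injective (≡.sym eq) (≡.trans (≡.sym (Inverse.strictlyInverseʳ elements _))
        (≡.trans (cong (Inverse.from elements) xᵢ≡xⱼ) (Inverse.strictlyInverseʳ elements _)))) E full

theorem4p3 : ∀ {c ℓ} (A : FiniteAbelianGroup c ℓ) →
    let open FiniteAbelianGroup A
        open GroupRing A
    in HasLatticeBasisOf Δ² ProductForm
       × (order > 4 ⊎ abelianGroup ≅ C₂×C₂ → HasLatticeBasisOf Δ² (HasLength 2))
theorem4p3 A = product-basis , λ order>4⊎Klein →
  let 4≤order = [ ℕ.<⇒≤ , Klein⇒4≤order ]′ order>4⊎Klein
      order>4⊎exponent2 = Sum.map id Klein⇒exponent2 order>4⊎Klein
  in case trivial-or-step of λ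
    { (inj₁ full) → contradiction (full⇒order≤ trivial full)
        (ℕ.<⇒≱ (ℕ.≤-trans (ℕ.s≤s (ℕ.s≤s ℕ.z≤n)) 4≤order))
    ; (inj₂ last) → let open LastStep last in
        length-two-basis H presentation extension full 4≤order order>4⊎exponent2 }
  where
  open Towers A
  open FiniteAbelianGroup A using (abelianGroup)
  open Subgroups abelianGroup using (trivial)
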